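{- Consider the Evacuation Problem (EP): given an evacuation framework $\mathcal{EF}=\langle G,s_0,\beta\rangle$ over time points $T=\{0,1,\dots,t_{\max}\}$ and a finite set $P$ of people, and a deadline $D\le t_{\max}$, find a strong evacuation schedule $es$ that maximizes the expected number $\mathbb{E}[N_{es}(D)]$ of people evacuated at or before time $D$. EP is NP-hard even when restricted to instances satisfying all of the following: (i) $c(e)=d(e)=1$ for each edge $e$ of $G$; (ii) at the initial state $s_0$, the people in $P$ are located in at most two vertices of $G$; (iii) for every strong evacuation schedule $es$, $\beta(es)$ is a pdf $\omega$ over a singleton $\{es'\}$, where $\omega(es')=1$.
   Context: Let $P$ be a finite set of people and $T=\{0,1,\dots,t_{\max}\}$ the set of time points. Building graph: a tuple $G=\langle V,E,EX,c,d\rangle$ with $V$ a finite set of vertices, $E\subseteq V\times V$ a set of edges, $EX\subset V$ a set of exits, $c:E\cup V\to\mathbb{Z}$ the capacity function and $d:E\cup V\to\mathbb{Z}$ the travel time function. It is assumed that $d(v)=0$ for all $v\in V$ and $c(v)\ge |P|$ for all $v\in EX$. Edges can be traversed in both directions, so "$e=(v_1,v_2)\in E$" below means that $e$ is an edge joining $v_1$ and $v_2$. State: a mapping $s:P\to V\cup E$ (the location of each person at a fixed time). Let $ST$ be the set of all states. Weak evacuation schedule (WES): a mapping $wes:T\to ST$ such that for every $p\in P$ (writing $wes_p(t)$ for $wes(t)(p)$): 1. if $wes_p(t)=v_1\in V$, then $wes_p(t+1)=v_1$, or there is $e=(v_1,v_2)\in E$ with $wes_p(t+1)=e$, or there is $e=(v_1,v_2)\in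 E$ with $wes_p(t+1)=v_2$; 2. if $wes_p(t)=e=(v_1,v_2)\in E$, then $wes_p(t+1)\in\{e,v_1,v_2\}$; 3. for every $e=(v_1,v_2)\in E$, if $wes_p(t)=v_1$, then $wes_p(t+k)=v_2$ only if $d(e)\le k$; 4. if $0\le t'<t''\le t_{\max}$ and $wes_p(t')\in EX$, then $wes_p(t'')=wes_p(t')$. Strong evacuation schedule (SES): a WES $es$ such that for all $t\in T$, $|\{p\in P: es_p(t)=v\}|\le c(v)$ for all $v\in V$ and $|\{p\in P: es_p(t)=e\}|\le c(e)$ for all $e\in E$, and such that $es_p(t_{\max})\in EX$ for every $p\in P$. Let $\mathcal{S}$ and $\mathcal{W}$ be the sets of all SESs and all WESs. A pdf over $\mathcal{W}$ is a map $\omega:\mathcal{W}\to[0,1]$ with $\sum_{w\in\mathcal{W}}\omega(w)=1$. A behavior model is a function $\beta$ assigning to each $es\in\mathcal{S}$ a pdf $\beta(es)$ over $\mathcal{W}$. An evacuation framework is a triple $\langle G,s_0,\beta\rangle$ with $s_0$ the state at time $0$; the schedules considered for it start at $s_0$, i.e. $es(0)=s_0$. As part of an instance, $\beta$ is given by a succinct description (an effective rule determining $\beta(es)$ from $es$), not by an explicit table over all schedules. For a schedule $es$ and $D\le t_{\max}$, $N_{es}(D)=|\{p\in P: es_p(D)\in EX\}|$ is the number of people evacuated by $D$. For an SES $es$ with $\omega=\beta(es)$, the expected number of people evacuated by $D$ is $\mathbb{E}[N_{es}(D)]=\sum_{es'\in\mathcal{W},\ \omega(es')>0}\omega(es')\,N_{es'}(D)$.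 -}

module Defs where

open import Data.Bool.Base using (Bool; true; false; T; if_then_else_)
open import Data.Empty using (⊥)
open import Data.Fin.Base using (Fin; suc; toℕ; inject₁; fromℕ)
import Data.Fin.Properties as Fin
open import Data.Fin.Subset using (Subset; _∈_; _⊂_; ⊤)
open import Data.Fin.Subset.Properties using (_∈?_)
open import Data.Integer.Base as ℤ using (ℤ; +_; -[1+_]; 0ℤ; 1ℤ)
open import Data.List.Base as List using (List; []; _∷_; length)
open import Data.List.Relation.Unary.All using (All)
open import Data.List.Relation.Unary.Unique.Propositional using (Unique)
open import Data.Maybe.Base using (Maybe; just; nothing)
open import Data.Nat.Base using (ℕ; zero; suc; _+_; _*_; _^_; _≤_; _≡ᵇ_)
open import Data.Nat.Binary.Base as ℕᵇ using (ℕᵇ; 2[1+_]; 1+[2_])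
open import Data.Product.Base using (Σ; Σ-syntax; ∃-syntax; _×_; _,_; proj₁; proj₂)
open import Data.Rational.Base as ℚ using (ℚ; 0ℚ; 1ℚ)
open import Data.Sum.Base using (_⊎_; inj₁; inj₂)
import Data.Sum.Properties as Sum
open import Data.Vec.Base as Vec using (Vec; lookup; count; toList)
open import Function.Bundles using (_⇔_)
open import Function.Definitions using (Injective)
open import Level using (0ℓ)
open import Relation.Binary.Definitions using (DecidableEquality)
open import Relation.Binary.PropositionalEquality using (_≡_)
open import Relation.Nullary.Decidable using (no)
open import Relation.Nullary.Negation using (¬_)
open import Relation.Unary using (Pred; Decidable)

-- The model of computation is the WHILE language of N. D. Jones
-- ("Computability and Complexity from a Programming Perspective"):
-- imperative programs over binary trees.  Time is charged by the size of
-- every tree computed, not by the number of steps: with unit cost, n steps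
-- of  X ≔ cons X X  would build a tree of size 2ⁿ.  With this charge, time
-- is polynomially related to Turing machine time for decision problems and
-- for functions alike.

infixr 5 _∙_

data Tree : Set where
  nil : Tree
  _∙_ : Tree → Tree → Tree

size : Tree → ℕ
size nil     = 1
size (a ∙ b) = suc (size a + size b)

Var : Set
Var = ℕ

data Expr : Set where
  var   : Var → Expr
  quot  : Tree → Expr
  cons  : Expr → Expr → Expr
  hd tl : Expr → Expr

data Mode : Set where
  plain oracle : Mode

infix  7 _≔_ _≔ask_
infixr 5 _⨟_

data Program : Mode → Set where
  _≔_    : ∀ {m} → Var → Expr → Program m
  _≔ask_ : Var → Expr → Program oracle
  _⨟_    : ∀ {m} → Program m → Program m → Program m
  cond   : ∀ {m} → Expr → Program m → Program m → Program m
  while  : ∀ {m} → Expr → Program m → Program m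

Store : Set
Store = Var → Tree

_[_↦_] : Store → Var → Tree → Store
(σ [ x ↦ a ]) y = if x ≡ᵇ y then a else σ y

head tail : Tree → Tree
head nil     = nil
head (a ∙ _) = a
tail nil     = nil
tail (_ ∙ b) = b

eval : Expr → Store → Tree
eval (var x)    σ = σ x
eval (quot a)   σ = a
eval (cons e f) σ = eval e σ ∙ eval f σ
eval (hd e)     σ = head (eval e σ)
eval (tl e)     σ = tail (eval e σ)

cost : Expr → Store → ℕ
cost (var x)    σ = size (σ x)
cost (quot a)   σ = size a
cost (cons e f) σ = cost e σ + cost f σ + size (eval (cons e f) σ)
cost (hd e)     σ = cost e σ + size (eval (hd e) σ)
cost (tl e)     σ = cost e σ + size (eval (tl e) σ)

Oracle : Set
Oracle = Tree → Tree

-- Run O p σ σ′ n: with oracle O, program p started in store σ halts in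
-- store σ′ after time n.  Tests take nil as false and other trees as true.
data Run (O : Oracle) : ∀ {m} → Program m → Store → Store → ℕ → Set where
  assign : ∀ {m x e σ} →
           Run O {m} (x ≔ e) σ (σ [ x ↦ eval e σ ]) (suc (cost e σ))
  ask    : ∀ {x e σ} →
           Run O (x ≔ask e) σ (σ [ x ↦ O (eval e σ) ])
             (suc (cost e σ + size (O (eval e σ))))
  seq    : ∀ {m} {p q : Program m} {σ σ′ σ″ i j} →
           Run O p σ σ′ i → Run O q σ′ σ″ j →
           Run O (p ⨟ q) σ σ″ (suc (i + j))
  cond-t : ∀ {m e} {p q : Program m} {σ σ′ a b n} →
           eval e σ ≡ a ∙ b → Run O p σ σ′ n →
           Run O (cond e p q) σ σ′ (suc (cost e σ + n))
  cond-f : ∀ {m e} {p q : Program m} {σ σ′ n} →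
           eval e σ ≡ nil → Run O q σ σ′ n →
           Run O (cond e p q) σ σ′ (suc (cost e σ + n))
  stop   : ∀ {m e} {p : Program m} {σ} →
           eval e σ ≡ nil →
           Run O (while e p) σ σ (suc (cost e σ))
  step   : ∀ {m e} {p : Program m} {σ σ′ σ″ a b i j} →
           eval e σ ≡ a ∙ b →
           Run O p σ σ′ i → Run O (while e p) σ′ σ″ j →
           Run O (while e p) σ σ″ (suc (cost e σ + i + j))

initial : Tree → Store
initial a zero    = a
initial a (suc _) = nil

-- Input and output are both held in variable 0.
Computes[_] : Oracle → ∀ {m} → Program m → Tree → Tree → ℕ → Set
Computes[ O ] p a b bound =
  ∃[ σ ] ∃[ n ] Run O p (initial a) σ n × σ 0 ≡ b × n ≤ bound

-- A plain program never consults its oracle, so any oracle will do here.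
Computes : Program plain → Tree → Tree → ℕ → Set
Computes = Computes[ (λ _ → nil) ]

encBool : Bool → Tree
encBool false = nil
encBool true  = nil ∙ nil

encUnary : ℕ → Tree
encUnary zero    = nil
encUnary (suc n) = nil ∙ encUnary n

encFin : ∀ {n} → Fin n → Tree
encFin i = encUnary (toℕ i)

encList : ∀ {A : Set} → (A → Tree) → List A → Tree
encList enc []       = nil
encList enc (x ∷ xs) = enc x ∙ encList enc xs

encVec : ∀ {A : Set} {n} → (A → Tree) → Vec A n → Tree
encVec enc v = encList enc (toList v)

encTable : ∀ {A : Set} {n} → (A → Tree) → (Fin n → A) → Tree
encTable enc f = encList enc (List.tabulate f)

encMaybe : ∀ {A : Set} → (A → Tree) → Maybe A → Tree
encMaybe enc nothing  = nil
encMaybe enc (just x) = nil ∙ enc x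

encℕᵇ : ℕᵇ → Tree
encℕᵇ ℕᵇ.zero  = nil
encℕᵇ 2[1+ b ] = encBool false ∙ encℕᵇ b
encℕᵇ 1+[2 b ] = encBool true ∙ encℕᵇ b

encBinary : ℕ → Tree
encBinary n = encℕᵇ (ℕᵇ.fromℕ n)

encℤ : ℤ → Tree
encℤ (+ n)    = encBool false ∙ encBinary n
encℤ -[1+ n ] = encBool true ∙ encBinary n

encℚ : ℚ → Tree
encℚ q = encℤ (ℚ.numerator q) ∙ encBinary (ℚ.denominator-1 q)

encExpr : Expr → Tree
encExpr (var x)    = encUnary 0 ∙ encUnary x
encExpr (quot a)   = encUnary 1 ∙ a
encExpr (cons e f) = encUnary 2 ∙ encExpr e ∙ encExpr f
encExpr (hd e)     = encUnary 3 ∙ encExpr e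
encExpr (tl e)     = encUnary 4 ∙ encExpr e

encProgram : ∀ {m} → Program m → Tree
encProgram (x ≔ e)      = encUnary 0 ∙ encUnary x ∙ encExpr e
encProgram (x ≔ask e)   = encUnary 1 ∙ encUnary x ∙ encExpr e
encProgram (p ⨟ q)      = encUnary 2 ∙ encProgram p ∙ encProgram q
encProgram (cond e p q) = encUnary 3 ∙ encExpr e ∙ encProgram p ∙ encProgram q
encProgram (while e p)  = encUnary 4 ∙ encExpr e ∙ encProgram p

Word : Set
Word = List Bool

encWord : Word → Tree
encWord = encList encBool

Language : Set₁
Language = Pred Word 0ℓ

poly : ℕ → ℕ → ℕ
poly k n = k * n ^ k + k

record NP (L : Language) : Set where
  field
    verifier : Program plain
    accepts  : Word → Word → Bool
    degree   : ℕ
    runs     : ∀ x y → Computes verifier (encWord x ∙ encWord y)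
                         (encBool (accepts x y)) (poly degree (length x + length y))
    correct  : ∀ x → L x ⇔ (∃[ y ] length y ≤ poly degree (length x) × T (accepts x y))

record SearchProblem : Set₁ where
  field
    Instance     : Set
    Solution     : Instance → Set
    IsSolution   : (I : Instance) → Solution I → Set
    encInstance  : Instance → Tree
    encSolution  : (I : Instance) → Solution I → Tree

_restrictedTo_ : (Π : SearchProblem) → Pred (SearchProblem.Instance Π) 0ℓ → SearchProblem
Π restrictedTo R = record
  { Instance    = Σ Instance R
  ; Solution    = λ (I , _) → Solution I
  ; IsSolution  = λ (I , _) → IsSolution I
  ; encInstance = λ (I , _) → encInstance I
  ; encSolution = λ (I , _) → encSolution I
  } where open SearchProblem Π

-- A solver returns a solution if there is one and "nothing" otherwise.  It is
-- unconstrained on trees that do not encode instances of the problem.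
Solves : Oracle → SearchProblem → Set
Solves O Π = (I : Instance) → ∃[ answer ]
    O (encInstance I) ≡ encMaybe (encSolution I) answer × Correct I answer
  where
  open SearchProblem Π
  Correct : (I : Instance) → Maybe (Solution I) → Set
  Correct I (just s) = IsSolution I s
  Correct I nothing  = ∀ s → ¬ IsSolution I s

-- Polynomial-time Turing reducibility, the notion of reduction that applies to
-- search problems (Garey and Johnson, section 5.1): one program and one
-- polynomial must work for every oracle that solves Π.
record _≤ᵀ_ (L : Language) (Π : SearchProblem) : Set where
  field
    reduction : Program oracle
    degree    : ℕ
    decides   : ∀ O → Solves O Π → ∀ x → ∃[ b ]
      Computes[ O ] reduction (encWord x) (encBool b) (poly degree (length x))
      × (L x ⇔ T b)

NP-hard : SearchProblem → Set₁
NP-hard Π = ∀ (L : Language) → NP L → L ≤ᵀ Π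

-- People are Fin |P|.  Edges are named by indices; since `ends` is injective,
-- they form a subset of V × V.
record BuildingGraph (|P| : ℕ) : Set where
  field
    |V| |E| : ℕ
    ends    : Fin |E| → Fin |V| × Fin |V|
    EX      : Subset |V|

  Vertex : Set
  Vertex = Fin |V|

  Edge : Set
  Edge = Fin |E|

  Location : Set
  Location = Vertex ⊎ Edge

  field
    c d            : Location → ℤ
    ends-injective : Injective _≡_ _≡_ ends
    EX-proper      : EX ⊂ ⊤
    d-vertex       : ∀ v → d (inj₁ v) ≡ 0ℤ
    c-exit         : ∀ v → v ∈ EX → + |P| ℤ.≤ c (inj₁ v)

  Joins : Edge → Vertex → Vertex → Set
  Joins e v₁ v₂ = ends e ≡ (v₁ , v₂) ⊎ ends e ≡ (v₂ , v₁)

  _≟ᴸ_ : DecidableEquality Location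
  _≟ᴸ_ = Sum.≡-dec Fin._≟_ Fin._≟_

  AtExit : Pred Location 0ℓ
  AtExit (inj₁ v) = v ∈ EX
  AtExit (inj₂ _) = ⊥

  atExit? : Decidable AtExit
  atExit? (inj₁ v) = v ∈? EX
  atExit? (inj₂ _) = no λ ()

  encLocation : Location → Tree
  encLocation (inj₁ v) = encBool false ∙ encFin v
  encLocation (inj₂ e) = encBool true ∙ encFin e

module Schedules {|P| : ℕ} (tmax : ℕ) (G : BuildingGraph |P|) where
  open BuildingGraph G

  Person Time State Schedule : Set
  Person   = Fin |P|
  Time     = Fin (suc tmax)
  State    = Vec Location |P|
  Schedule = Vec State (suc tmax)

  at : Schedule → Person → Time → Location
  at w p t = lookup (lookup w t) p

  record IsWES (w : Schedule) : Set where
    field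
      from-vertex : ∀ p (t : Fin tmax) v₁ → at w p (inject₁ t) ≡ inj₁ v₁ →
          at w p (suc t) ≡ inj₁ v₁
        ⊎ (∃[ e ] ∃[ v₂ ] Joins e v₁ v₂ × at w p (suc t) ≡ inj₂ e)
        ⊎ (∃[ e ] ∃[ v₂ ] Joins e v₁ v₂ × at w p (suc t) ≡ inj₁ v₂)
      from-edge : ∀ p (t : Fin tmax) e v₁ v₂ → Joins e v₁ v₂ →
          at w p (inject₁ t) ≡ inj₂ e →
          at w p (suc t) ≡ inj₂ e
        ⊎ at w p (suc t) ≡ inj₁ v₁
        ⊎ at w p (suc t) ≡ inj₁ v₂
      -- For an edge joining v₁ and v₂, in either direction; k = 0 matters only
      -- for loops.
      travel-time : ∀ p e v₁ v₂ (t t′ : Time) k → Joins e v₁ v₂ →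
        toℕ t′ ≡ toℕ t + k →
        at w p t ≡ inj₁ v₁ → at w p t′ ≡ inj₁ v₂ → d (inj₂ e) ℤ.≤ + k
      exit-final : ∀ p (t′ t″ : Time) → suc (toℕ t′) ≤ toℕ t″ →
        AtExit (at w p t′) → at w p t″ ≡ at w p t′

  record IsSES (w : Schedule) : Set where
    field
      isWES     : IsWES w
      capacity  : ∀ t ℓ → + count (ℓ ≟ᴸ_) (lookup w t) ℤ.≤ c ℓ
      evacuated : ∀ p → AtExit (at w p (fromℕ tmax))

  N : Schedule → Time → ℕ
  N w D = count atExit? (lookup w D)

  -- A pdf ω on the finite set of WESs, given by listing its support: the pairs
  -- (w , ω(w)) with ω(w) > 0.
  Distribution : Set
  Distribution = List (Schedule × ℚ)

  sum : List ℚ → ℚ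
  sum = List.foldr ℚ._+_ 0ℚ

  record IsPDF (ω : Distribution) : Set where
    field
      support : All (λ (w , q) → IsWES w × 0ℚ ℚ.< q × q ℚ.≤ 1ℚ) ω
      unique  : Unique (List.map proj₁ ω)
      total   : sum (List.map proj₂ ω) ≡ 1ℚ

  𝔼N : Distribution → Time → ℚ
  𝔼N ω D = sum (List.map (λ (w , q) → q ℚ.* (+ N w D ℚ./ 1)) ω)

  encState : State → Tree
  encState = encVec encLocation

  encSchedule : Schedule → Tree
  encSchedule = encVec encState

  encDistribution : Distribution → Tree
  encDistribution = encList (λ (w , q) → encSchedule w ∙ encℚ q)

record EvacuationFramework (|P| tmax : ℕ) : Set where
  field
    G : BuildingGraph |P|
  open BuildingGraph G public
  open Schedules tmax G public
  field
    s₀      : State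
    -- Only the values of β at SESs are meaningful.
    β       : Schedule → Distribution
    β-pdf   : ∀ es → IsSES es → IsPDF (β es)
    β-start : ∀ es → IsSES es → Vec.head es ≡ s₀ →
              All (λ (w , _) → Vec.head w ≡ s₀) (β es)

  Feasible : Schedule → Set
  Feasible es = IsSES es × Vec.head es ≡ s₀

  Optimal : Time → Schedule → Set
  Optimal D es = Feasible es × (∀ es′ → Feasible es′ → 𝔼N (β es′) D ℚ.≤ 𝔼N (β es) D)

-- The behavior model enters the instance through `rule`, a program computing β
-- on SESs, with a bound `budget` on its running time.  The budget is encoded
-- in unary, which makes β computable in time polynomial in the instance size.
record EPInstance : Set where
  field
    |P| tmax : ℕ
    EF       : EvacuationFramework |P| tmax
  open EvacuationFramework EF public
  field
    D        : Time
    rule     : Program plain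
    budget   : ℕ
    rule-β   : ∀ es → IsSES es →
               Computes rule (encSchedule es) (encDistribution (β es)) budget

-- People, time points, vertices and edges are finite sets whose elements are
-- part of the instance, so their cardinalities and elements are encoded in
-- unary; capacities and travel times are numbers and are encoded in binary.
encEPInstance : EPInstance → Tree
encEPInstance I =
    encUnary |P| ∙ encUnary tmax ∙ encUnary |V| ∙ encUnary |E|
  ∙ encTable (λ (u , v) → encFin u ∙ encFin v) ends
  ∙ encVec encBool EX
  ∙ encTable encℤ (λ v → c (inj₁ v))
  ∙ encTable encℤ (λ e → c (inj₂ e))
  ∙ encTable encℤ (λ v → d (inj₁ v))
  ∙ encTable encℤ (λ e → d (inj₂ e))
  ∙ encState s₀
  ∙ encFin D
  ∙ encProgram rule ∙ encUnary budget
  where open EPInstance I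

EP : SearchProblem
EP = record
  { Instance    = EPInstance
  ; Solution    = EPInstance.Schedule
  ; IsSolution  = λ I → EPInstance.Optimal I (EPInstance.D I)
  ; encInstance = encEPInstance
  ; encSolution = EPInstance.encSchedule
  }

module _ (I : EPInstance) where
  open EPInstance I

  UnitEdges : Set
  UnitEdges = ∀ e → c (inj₂ e) ≡ 1ℤ × d (inj₂ e) ≡ 1ℤ

  AtMostTwoOrigins : Set
  AtMostTwoOrigins = Σ[ u ∈ Vertex ] Σ[ v ∈ Vertex ]
    (∀ p → lookup s₀ p ≡ inj₁ u ⊎ lookup s₀ p ≡ inj₁ v)

  DeterministicBehavior : Set
  DeterministicBehavior = ∀ es → IsSES es → ∃[ es′ ] β es ≡ (es′ , 1ℚ) ∷ []

{-# OPTIONS --safe #-}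

module Submission where

-- One person walks on a graph with a single edge, from a vertex to an exit.
-- Up to the moment of exit the walk is free to wait at the vertex or to be on
-- the edge, so the feasible schedules with final time m + 1 are the words of
-- length at most m, the candidate certificates of an NP language.  The behavior
-- model is given by a program, hence it may run the verifier: it returns the
-- planned schedule if the verifier accepts the word and one that never leaves
-- otherwise.  An optimal schedule thus decides membership, and no detour through
-- a concrete NP-complete problem is needed.

open import Defs
open import Data.Bool.Base using (Bool; true; false; T; if_then_else_)
open import Data.Bool.Properties using (T-≡)
open import Data.Empty using (⊥-elim)
open import Data.Fin.Base using (Fin; zero; suc; toℕ; fromℕ; inject₁)
open import Data.Fin.Patterns using (0F; 1F; 2F; 3F; 4F; 5F)
open import Data.Fin.Properties using (toℕ-fromℕ; toℕ-inject₁; toℕ-injective)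
open import Data.Fin.Subset using (inside; outside)
open import Data.Integer.Base as ℤ using (0ℤ; 1ℤ; +≤+)
open import Data.List.Base using (List; []; _∷_; length; drop; reverse; _ʳ++_)
open import Data.List.Properties using (length-reverse; reverse-involutive)
open import Data.List.Relation.Unary.All using ([]; _∷_)
open import Data.List.Relation.Unary.AllPairs using ([]; _∷_)
open import Data.Maybe.Base using (just; nothing)
open import Data.Nat.Base
open import Data.Nat.Properties
open import Data.Nat.Tactic.RingSolver using (solve-∀)
open import Data.Product.Base using (∃-syntax; _×_; _,_; proj₁; proj₂)
open import Data.Rational.Base as ℚ using (ℚ; 0ℚ; 1ℚ)
import Data.Rational.Properties as ℚ
open import Data.Sum.Base using (_⊎_; inj₁; inj₂)
open import Data.Vec.Base as Vec
  using (Vec; []; _∷_; here; there; lookup; toList; tabulate; replicate; count; _[_]≔_)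
open import Data.Vec.Properties using (lookup∘tabulate; lookup-replicate; count≤n; length-toList)
open import Function.Base using (case_of_)
open import Function.Bundles using (_⇔_; Equivalence; mk⇔)
open import Relation.Binary.PropositionalEquality
open import Relation.Nullary.Decidable using (from-yes; from-no)
open import Relation.Nullary.Negation using (¬_)

-- The reduction must be an explicit program that writes down another program, with proven time
-- bounds. The word `x` enters `rule x` through one quoted constant only, so the code of the rule is
-- a fixed tree with the code of `x` inserted. The budget is rounded up to `poly K` of the length of
-- `x`, with `K` fixed by `np`, so that the construction which writes the time horizon also writes
-- the budget. Membership is read off without arithmetic on expectations: the reduction decodes the
-- reply and runs the verifier once more. If a certificate exists, the optimum is 1 and every
-- optimal plan spells an accepted word; conversely, an accepted word spelled by a feasible plan is
-- short enough to be a certificate. Since the time of exit is free, words of every length up to `m`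
-- occur and certificates need no padding.

-- Polynomial bounds

infixl 6 _⊕_
infixl 7 _⊗_
infixr 8 _↑_
infixr 9 _⊚_

-- Syntax rather than functions, so that unification can assemble the time bound of a program from
-- its parts and `deg` can be computed from it. Composition is included because each part runs on
-- values enlarged by the parts before it.
data Poly : Set where
  con         : ℕ → Poly
  X           : Poly
  _⊕_ _⊗_ _⊚_ : Poly → Poly → Poly
  _↑_         : Poly → ℕ → Poly

⟦_⟧ : Poly → ℕ → ℕ
⟦ con c ⟧ n = c
⟦ X ⟧     n = n
⟦ P ⊕ Q ⟧ n = ⟦ P ⟧ n + ⟦ Q ⟧ n
⟦ P ⊗ Q ⟧ n = ⟦ P ⟧ n * ⟦ Q ⟧ n
⟦ P ⊚ Q ⟧ n = ⟦ P ⟧ (⟦ Q ⟧ n)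
⟦ P ↑ k ⟧ n = ⟦ P ⟧ n ^ k

⟦⟧-mono : ∀ P {m n} → m ≤ n → ⟦ P ⟧ m ≤ ⟦ P ⟧ n
⟦⟧-mono (con c) m≤n = ≤-refl
⟦⟧-mono X       m≤n = m≤n
⟦⟧-mono (P ⊕ Q) m≤n = +-mono-≤ (⟦⟧-mono P m≤n) (⟦⟧-mono Q m≤n)
⟦⟧-mono (P ⊗ Q) m≤n = *-mono-≤ (⟦⟧-mono P m≤n) (⟦⟧-mono Q m≤n)
⟦⟧-mono (P ⊚ Q) m≤n = ⟦⟧-mono P (⟦⟧-mono Q m≤n)
⟦⟧-mono (P ↑ k) m≤n = ^-monoˡ-≤ k (⟦⟧-mono P m≤n)

-- Not the degree, but an exponent `e` for which `(2 + n) ^ e` dominates the polynomial. The base is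
-- at least 2, so a constant `c` is absorbed by the exponent `c`, and a sum by one further factor.
deg : Poly → ℕ
deg (con c) = c
deg X       = 1
deg (P ⊕ Q) = suc (deg P + deg Q)
deg (P ⊗ Q) = deg P + deg Q
deg (P ⊚ Q) = (2 + deg Q) * deg P
deg (P ↑ k) = deg P * k

n≤a^n : ∀ a n → 2 ≤ a → n ≤ a ^ n
n≤a^n a@(suc _) zero    2≤a = z≤n
n≤a^n a@(suc _) (suc n) 2≤a = begin
  suc n             ≤⟨ +-mono-≤ (m^n>0 a n) (n≤a^n a n 2≤a) ⟩
  a ^ n + a ^ n     ≡⟨ cong (a ^ n +_) (+-identityʳ (a ^ n)) ⟨
  2 * a ^ n         ≤⟨ *-monoˡ-≤ (a ^ n) 2≤a ⟩
  a ^ suc n         ∎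
  where open ≤-Reasoning

⟦⟧≤2+n^deg : ∀ P n → ⟦ P ⟧ n ≤ (2 + n) ^ deg P
⟦⟧≤2+n^deg (con c) n = n≤a^n (2 + n) c (s≤s (s≤s z≤n))
⟦⟧≤2+n^deg X       n = ≤-trans (m≤n+m n 2) (≤-reflexive (sym (*-identityʳ (2 + n))))
⟦⟧≤2+n^deg (P ⊕ Q) n = begin
  ⟦ P ⟧ n + ⟦ Q ⟧ n          ≤⟨ +-mono-≤ (⟦⟧≤2+n^deg P n) (⟦⟧≤2+n^deg Q n) ⟩
  b ^ p + b ^ q              ≤⟨ +-mono-≤ (^-monoʳ-≤ b (m≤m+n p q)) (^-monoʳ-≤ b (m≤n+m q p)) ⟩
  b ^ (p + q) + b ^ (p + q)  ≡⟨ cong (b ^ (p + q) +_) (+-identityʳ _) ⟨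
  2 * b ^ (p + q)            ≤⟨ *-monoˡ-≤ (b ^ (p + q)) (m≤m+n 2 n) ⟩
  b ^ suc (p + q)            ∎
  where
  open ≤-Reasoning
  b = 2 + n
  p = deg P
  q = deg Q
⟦⟧≤2+n^deg (P ⊗ Q) n = ≤-trans
  (*-mono-≤ (⟦⟧≤2+n^deg P n) (⟦⟧≤2+n^deg Q n))
  (≤-reflexive (sym (^-distribˡ-+-* (2 + n) (deg P) (deg Q))))
⟦⟧≤2+n^deg (P ⊚ Q) n = begin
  ⟦ P ⟧ (⟦ Q ⟧ n)               ≤⟨ ⟦⟧≤2+n^deg P (⟦ Q ⟧ n) ⟩
  (2 + ⟦ Q ⟧ n) ^ deg P         ≤⟨ ^-monoˡ-≤ (deg P) 2+Q≤ ⟩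
  (b ^ (2 + deg Q)) ^ deg P     ≡⟨ ^-*-assoc b (2 + deg Q) (deg P) ⟩
  b ^ ((2 + deg Q) * deg P)     ∎
  where
  open ≤-Reasoning
  b = 2 + n
  q = b ^ deg Q
  -- The two extra factors of `b` absorb the summand 2: as `1 ≤ q`, `2 + q ≤ 4 * q ≤ b * b * q`.
  2+Q≤ : 2 + ⟦ Q ⟧ n ≤ b ^ (2 + deg Q)
  2+Q≤ = begin
    2 + ⟦ Q ⟧ n            ≤⟨ +-mono-≤ (*-monoʳ-≤ 2 (m^n>0 b (deg Q))) (⟦⟧≤2+n^deg Q n) ⟩
    2 * q + q              ≤⟨ m≤m+n (2 * q + q) q ⟩
    2 * q + q + q          ≡⟨ double-double q ⟩
    2 * (2 * q)            ≤⟨ *-mono-≤ (m≤m+n 2 n) (*-monoˡ-≤ q (m≤m+n 2 n)) ⟩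
    b * (b * q)            ∎
    where
    double-double : ∀ q → 2 * q + q + q ≡ 2 * (2 * q)
    double-double = solve-∀
⟦⟧≤2+n^deg (P ↑ k) n = ≤-trans
  (^-monoˡ-≤ k (⟦⟧≤2+n^deg P n))
  (≤-reflexive (^-*-assoc (2 + n) (deg P) k))

^-distribʳ-* : ∀ k m n → (m * n) ^ k ≡ m ^ k * n ^ k
^-distribʳ-* zero    m n = refl
^-distribʳ-* (suc k) m n rewrite ^-distribʳ-* k m n = [m*n]*[o*p]≡[m*o]*[n*p] m n (m ^ k) (n ^ k)

-- For positive `n`, `2 + n ≤ 3 * n` gives the bound `3 ^ c * n ^ c` with `c = deg P`. Since
-- `c ≤ 3 ^ c`, the single number `3 ^ c` serves as coefficient, exponent and constant term; the
-- last covers `n = 0`.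
⟦⟧≤poly-3^deg : ∀ P n → ⟦ P ⟧ n ≤ poly (3 ^ deg P) n
⟦⟧≤poly-3^deg P n = ≤-trans (⟦⟧≤2+n^deg P n) (2+n^c≤poly n)
  where
  open ≤-Reasoning
  c = deg P
  K = 3 ^ c
  2+n^c≤poly : ∀ n → (2 + n) ^ c ≤ poly K n
  2+n^c≤poly zero = ≤-trans (^-monoˡ-≤ c (n≤1+n 2)) (m≤n+m K (K * 0 ^ K))
  2+n^c≤poly n@(suc m) = begin
    (2 + n) ^ c      ≤⟨ ^-monoˡ-≤ c 2+n≤3n ⟩
    (3 * n) ^ c      ≡⟨ ^-distribʳ-* c 3 n ⟩
    K * n ^ c        ≤⟨ *-monoʳ-≤ K (^-monoʳ-≤ n (n≤a^n 3 c (s≤s (s≤s z≤n)))) ⟩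
    K * n ^ K        ≤⟨ m≤m+n _ K ⟩
    poly K n         ∎
    where
    3+m+2m : ∀ m → (3 + m) + 2 * m ≡ 3 * suc m
    3+m+2m = solve-∀
    2+n≤3n : 3 + m ≤ 3 * suc m
    2+n≤3n = ≤-trans (m≤m+n (3 + m) (2 * m)) (≤-reflexive (3+m+2m m))

-- Degrees and time bounds are abstract because Agda would otherwise evaluate
-- these astronomical numbers.
abstract
  polyDegree : Poly → ℕ
  polyDegree P = 3 ^ deg P

  ⟦⟧≤poly : ∀ P n → ⟦ P ⟧ n ≤ poly (polyDegree P) n
  ⟦⟧≤poly = ⟦⟧≤poly-3^deg

-- Runs up to pointwise equality of stores

infix 4 _≗ₛ_
_≗ₛ_ : Store → Store → Set
σ ≗ₛ τ = ∀ x → σ x ≡ τ x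

eval-cong : ∀ e {σ τ} → σ ≗ₛ τ → eval e σ ≡ eval e τ
eval-cong (var x)    σ≗τ = σ≗τ x
eval-cong (quot a)   σ≗τ = refl
eval-cong (cons e f) σ≗τ = cong₂ _∙_ (eval-cong e σ≗τ) (eval-cong f σ≗τ)
eval-cong (hd e)     σ≗τ = cong head (eval-cong e σ≗τ)
eval-cong (tl e)     σ≗τ = cong tail (eval-cong e σ≗τ)

cost-cong : ∀ e {σ τ} → σ ≗ₛ τ → cost e σ ≡ cost e τ
cost-cong (var x)    σ≗τ = cong size (σ≗τ x)
cost-cong (quot a)   σ≗τ = refl
cost-cong (cons e f) σ≗τ = cong₂ _+_ (cong₂ _+_ (cost-cong e σ≗τ) (cost-cong f σ≗τ))
                                     (cong size (eval-cong (cons e f) σ≗τ))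
cost-cong (hd e)     σ≗τ = cong₂ _+_ (cost-cong e σ≗τ) (cong size (eval-cong (hd e) σ≗τ))
cost-cong (tl e)     σ≗τ = cong₂ _+_ (cost-cong e σ≗τ) (cong size (eval-cong (tl e) σ≗τ))

update-cong : ∀ {σ τ} x {a b} → σ ≗ₛ τ → a ≡ b → σ [ x ↦ a ] ≗ₛ τ [ x ↦ b ]
update-cong x σ≗τ a≡b y with x ≡ᵇ y
... | true  = a≡b
... | false = σ≗τ y

-- Stores are functions, so two computations of the same values agree only pointwise. Replaying a
-- run from an agreeing store keeps its exact time, so runs can be chained without loss.
run-cong : ∀ {O m} {p : Program m} {σ σ′ τ n} → Run O p σ σ′ n → σ ≗ₛ τ →
           ∃[ τ′ ] Run O p τ τ′ n × σ′ ≗ₛ τ′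
run-cong (assign {x = x} {e}) σ≗τ rewrite cost-cong e σ≗τ =
  _ , assign , update-cong x σ≗τ (eval-cong e σ≗τ)
run-cong {O} (ask {x} {e}) σ≗τ rewrite cost-cong e σ≗τ | eval-cong e σ≗τ =
  _ , ask , update-cong x σ≗τ refl
run-cong (seq r s) σ≗τ with run-cong r σ≗τ
... | _ , r′ , eq with run-cong s eq
... | _ , s′ , eq′ = _ , seq r′ s′ , eq′
run-cong (cond-t {e = e} t r) σ≗τ with run-cong r σ≗τ
... | _ , r′ , eq rewrite cost-cong e σ≗τ =
  _ , cond-t (trans (sym (eval-cong e σ≗τ)) t) r′ , eq
run-cong (cond-f {e = e} t r) σ≗τ with run-cong r σ≗τ
... | _ , r′ , eq rewrite cost-cong e σ≗τ =
  _ , cond-f (trans (sym (eval-cong e σ≗τ)) t) r′ , eq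
run-cong (stop {e = e} t) σ≗τ rewrite cost-cong e σ≗τ =
  _ , stop (trans (sym (eval-cong e σ≗τ)) t) , σ≗τ
run-cong (step {e = e} t r s) σ≗τ with run-cong r σ≗τ
... | _ , r′ , eq with run-cong s eq
... | _ , s′ , eq′ rewrite cost-cong e σ≗τ =
  _ , step (trans (sym (eval-cong e σ≗τ)) t) r′ s′ , eq′

-- Growth of values along a run

BoundedStore : ℕ → Store → Set
BoundedStore S σ = ∀ x → size (σ x) ≤ S

0<size : ∀ a → 0 < size a
0<size nil     = s≤s z≤n
0<size (_ ∙ _) = s≤s z≤n

size-head : ∀ a → size (head a) ≤ size a
size-head nil     = ≤-refl
size-head (a ∙ b) = m≤n⇒m≤1+n (m≤m+n _ _)

size-tail : ∀ a → size (tail a) ≤ size a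
size-tail nil     = ≤-refl
size-tail (a ∙ b) = m≤n⇒m≤1+n (m≤n+m _ _)

size≤cost : ∀ e σ → size (eval e σ) ≤ cost e σ
size≤cost (var x)    σ = ≤-refl
size≤cost (quot a)   σ = ≤-refl
size≤cost (cons e f) σ = m≤n+m _ (cost e σ + cost f σ)
size≤cost (hd e)     σ = m≤n+m _ (cost e σ)
size≤cost (tl e)     σ = m≤n+m _ (cost e σ)

update-bounded : ∀ {S σ} x {a} → BoundedStore S σ → size a ≤ S → BoundedStore S (σ [ x ↦ a ])
update-bounded x bσ ba y with x ≡ᵇ y
... | true  = ba
... | false = bσ y

bounded-mono : ∀ {S S′ σ} → S ≤ S′ → BoundedStore S σ → BoundedStore S′ σ
bounded-mono S≤S′ b x = ≤-trans (b x) S≤S′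

-- Every tree written is charged its size, oracle replies included, so no value outgrows the time
-- spent. A time bound for one part thus becomes a size bound for the next.
run-bounded : ∀ {O m} {p : Program m} {σ σ′ n S} → Run O p σ σ′ n →
              BoundedStore S σ → BoundedStore (S + n) σ′
run-bounded {S = S} (assign {x = x} {e} {σ}) b =
  update-bounded x (bounded-mono (m≤m+n S _) b)
    (≤-trans (m≤n⇒m≤1+n (size≤cost e σ)) (m≤n+m _ S))
run-bounded {S = S} (ask {x} {e} {σ}) b =
  update-bounded x (bounded-mono (m≤m+n S _) b)
    (≤-trans (m≤n⇒m≤1+n (m≤n+m _ (cost e σ))) (m≤n+m _ S))
run-bounded {S = S} (seq {i = i} {j} r s) b =
  bounded-mono (≤-trans (≤-reflexive (+-assoc S i j)) (+-monoʳ-≤ S (n≤1+n _)))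
    (run-bounded s (run-bounded r b))
run-bounded {S = S} (cond-t {n = n} _ r) b =
  bounded-mono (+-monoʳ-≤ S (m≤n⇒m≤1+n (m≤n+m n _))) (run-bounded r b)
run-bounded {S = S} (cond-f {n = n} _ r) b =
  bounded-mono (+-monoʳ-≤ S (m≤n⇒m≤1+n (m≤n+m n _))) (run-bounded r b)
run-bounded {S = S} (stop _) b = bounded-mono (m≤m+n S _) b
run-bounded {S = S} (step {e = e} {σ = σ} {i = i} {j} _ r s) b =
  bounded-mono (≤-trans (≤-reflexive (+-assoc S i j))
                 (+-monoʳ-≤ S (m≤n⇒m≤1+n (+-monoˡ-≤ j (m≤n+m i _)))))
    (run-bounded s (run-bounded r b))

-- Executions on registers with polynomial time bounds

-- A store whose first n variables are the registers.  This is a record rather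
-- than a function into Store so that unification can recover the registers.
record Config (n : ℕ) : Set where
  constructor ⟨_∣_⟩
  field
    registers : Vec Tree n
    rest      : Store

store : ∀ {n} → Config n → Store
store ⟨ []    ∣ ρ ⟩ x       = ρ x
store ⟨ a ∷ v ∣ ρ ⟩ zero    = a
store ⟨ a ∷ v ∣ ρ ⟩ (suc x) = store ⟨ v ∣ ρ ⟩ x

update-register : ∀ {n} (v : Vec Tree n) ρ (i : Fin n) a →
                  store ⟨ v ∣ ρ ⟩ [ toℕ i ↦ a ] ≗ₛ store ⟨ v [ i ]≔ a ∣ ρ ⟩
update-register (b ∷ v) ρ zero    a zero    = refl
update-register (b ∷ v) ρ zero    a (suc x) = refl
update-register (b ∷ v) ρ (suc i) a zero    = refl
update-register (b ∷ v) ρ (suc i) a (suc x) = update-register v ρ i a x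

update-rest : ∀ {n} (v : Vec Tree n) ρ x a →
              store ⟨ v ∣ ρ ⟩ [ n + x ↦ a ] ≗ₛ store ⟨ v ∣ ρ [ x ↦ a ] ⟩
update-rest []      ρ x a y       = refl
update-rest (b ∷ v) ρ x a zero    = refl
update-rest (b ∷ v) ρ x a (suc y) = update-rest v ρ x a y

lookup-rest : ∀ {n} (v : Vec Tree n) ρ x → store ⟨ v ∣ ρ ⟩ (n + x) ≡ ρ x
lookup-rest []      ρ x = refl
lookup-rest (a ∷ v) ρ x = lookup-rest v ρ x

record Bounded {n} (S : ℕ) (γ : Config n) : Set where
  constructor bounded
  field get : BoundedStore S (store γ)
open Bounded

bounded-weaken : ∀ {n S S′} {γ : Config n} → S ≤ S′ → Bounded S γ → Bounded S′ γ
bounded-weaken S≤S′ (bounded b) = bounded (bounded-mono S≤S′ b)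

bounded-set : ∀ {n S ρ} {v : Vec Tree n} (i : Fin n) {a} → Bounded S ⟨ v ∣ ρ ⟩ → size a ≤ S →
              Bounded S ⟨ v [ i ]≔ a ∣ ρ ⟩
bounded-set {ρ = ρ} {v} i {a} (bounded b) a≤ = bounded λ x →
  subst (λ t → size t ≤ _) (update-register v ρ i a x) (update-bounded (toℕ i) b a≤ x)

-- S bounds the sizes of all values in γ, and P expresses the time in terms of S.
record Exec (O : Oracle) {m n} (p : Program m) (γ δ : Config n) (P : Poly) (S : ℕ) : Set where
  constructor exec
  field
    {final} : Store
    {time}  : ℕ
    run     : Run O p (store γ) final time
    result  : final ≗ₛ store δ
    bound   : time ≤ ⟦ P ⟧ S

sizeP : Expr → Poly
sizeP (var x)    = X
sizeP (quot a)   = con (size a)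
sizeP (cons e f) = con 1 ⊕ (sizeP e ⊕ sizeP f)
sizeP (hd e)     = sizeP e
sizeP (tl e)     = sizeP e

costP : Expr → Poly
costP (var x)    = X
costP (quot a)   = con (size a)
costP (cons e f) = costP e ⊕ costP f ⊕ sizeP (cons e f)
costP (hd e)     = costP e ⊕ sizeP e
costP (tl e)     = costP e ⊕ sizeP e

module _ {S σ} (b : BoundedStore S σ) where

  size-bound : ∀ e → size (eval e σ) ≤ ⟦ sizeP e ⟧ S
  size-bound (var x)    = b x
  size-bound (quot a)   = ≤-refl
  size-bound (cons e f) = s≤s (+-mono-≤ (size-bound e) (size-bound f))
  size-bound (hd e)     = ≤-trans (size-head (eval e σ)) (size-bound e)
  size-bound (tl e)     = ≤-trans (size-tail (eval e σ)) (size-bound e)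

  cost-bound : ∀ e → cost e σ ≤ ⟦ costP e ⟧ S
  cost-bound (var x)    = b x
  cost-bound (quot a)   = ≤-refl
  cost-bound (cons e f) = +-mono-≤ (+-mono-≤ (cost-bound e) (cost-bound f)) (size-bound (cons e f))
  cost-bound (hd e)     = +-mono-≤ (cost-bound e) (≤-trans (size-head (eval e σ)) (size-bound e))
  cost-bound (tl e)     = +-mono-≤ (cost-bound e) (≤-trans (size-tail (eval e σ)) (size-bound e))

loopP : Expr → Poly → Poly
loopP e P = con 1 ⊕ costP e ⊕ P

module _ {O : Oracle} {m : Mode} {n : ℕ} where

  weaken : ∀ {p : Program m} {γ δ : Config n} {P Q S S′} → ⟦ P ⟧ S ≤ ⟦ Q ⟧ S′ →
           Exec O p γ δ P S → Exec O p γ δ Q S′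
  weaken P≤Q (exec r eq t≤) = exec r eq (≤-trans t≤ P≤Q)

  exec-≗ : ∀ {p : Program m} {γ δ ε : Config n} {P S} → store δ ≗ₛ store ε →
           Exec O p γ δ P S → Exec O p γ ε P S
  exec-≗ δ≗ε (exec r eq t≤) = exec r (λ x → trans (eq x) (δ≗ε x)) t≤

  exec-bounded : ∀ {p : Program m} {γ δ : Config n} {P S} →
                 Exec O p γ δ P S → Bounded S γ → Bounded (⟦ X ⊕ P ⟧ S) δ
  exec-bounded {S = S} (exec r eq t≤) (bounded b) = bounded λ x →
    subst (λ t → size t ≤ _) (eq x) (≤-trans (run-bounded r b x) (+-monoʳ-≤ S t≤))

  infixr 5 _⨾_ _⨾ᵇ_

  -- For an intermediate store known to obey the same size bound.
  _⨾_ : ∀ {p q : Program m} {γ δ ε : Config n} {P Q S} →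
        Exec O p γ δ P S → Exec O q δ ε Q S →
        Exec O (p ⨟ q) γ ε (con 1 ⊕ (P ⊕ Q)) S
  exec r eq t≤ ⨾ exec s eq′ u≤ with run-cong s (λ x → sym (eq x))
  ... | _ , s′ , eq″ =
    exec (seq r s′) (λ x → trans (sym (eq″ x)) (eq′ x)) (s≤s (+-mono-≤ t≤ u≤))

  -- In general, values may have grown by the time of the first part.
  _⨾ᵇ_ : ∀ {p q : Program m} {γ δ ε : Config n} {P Q S} →
         Exec O p γ δ P S → Exec O q δ ε Q (⟦ X ⊕ P ⟧ S) →
         Exec O (p ⨟ q) γ ε (con 1 ⊕ (P ⊕ Q ⊚ (X ⊕ P))) S
  _⨾ᵇ_ {P = P} {Q} r (exec s eq u≤) = weaken ≤-refl (r ⨾ exec {P = Q ⊚ (X ⊕ P)} s eq u≤)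

  exec-cond-t : ∀ {e} {p q : Program m} {γ δ : Config n} {a b P S} →
                Bounded S γ → eval e (store γ) ≡ a ∙ b →
                Exec O p γ δ P S → Exec O (cond e p q) γ δ (con 1 ⊕ (costP e ⊕ P)) S
  exec-cond-t {e} bγ t (exec r eq t≤) = exec (cond-t t r) eq (s≤s (+-mono-≤ (cost-bound (get bγ) e) t≤))

  exec-cond-f : ∀ {e} {p q : Program m} {γ δ : Config n} {P S} →
                Bounded S γ → eval e (store γ) ≡ nil →
                Exec O q γ δ P S → Exec O (cond e p q) γ δ (con 1 ⊕ (costP e ⊕ P)) S
  exec-cond-f {e} bγ t (exec r eq t≤) = exec (cond-f t r) eq (s≤s (+-mono-≤ (cost-bound (get bγ) e) t≤))

  -- The failing test is charged like a full pass, so the factor counts the passes plus one.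
  exec-stop : ∀ {e} {p : Program m} {γ : Config n} {P S} →
              Bounded S γ → eval e (store γ) ≡ nil →
              Exec O (while e p) γ γ (con 1 ⊗ loopP e P) S
  exec-stop {e} {P = P} {S} bγ t = exec (stop t) (λ _ → refl)
    (≤-trans (s≤s (≤-trans (cost-bound (get bγ) e) (m≤m+n _ (⟦ P ⟧ S)))) (m≤m+n _ 0))

  exec-step : ∀ {e} {p : Program m} {γ δ ε : Config n} {a b k P S} →
              Bounded S γ → eval e (store γ) ≡ a ∙ b →
              Exec O p γ δ P S → Exec O (while e p) δ ε (con k ⊗ loopP e P) S →
              Exec O (while e p) γ ε (con (suc k) ⊗ loopP e P) S
  exec-step {e} bγ t (exec r eq t≤) (exec s eq′ u≤) with run-cong s (λ x → sym (eq x))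
  ... | _ , s′ , eq″ = exec (step t r s′) (λ x → trans (sym (eq″ x)) (eq′ x))
    (+-mono-≤ (s≤s (+-mono-≤ (cost-bound (get bγ) e) t≤)) u≤)

  set : ∀ {S ρ} {v : Vec Tree n} (i : Fin n) e → Bounded S ⟨ v ∣ ρ ⟩ →
        Exec O {m} (toℕ i ≔ e) ⟨ v ∣ ρ ⟩ ⟨ v [ i ]≔ eval e (store ⟨ v ∣ ρ ⟩) ∣ ρ ⟩
          (con 1 ⊕ costP e) S
  set {ρ = ρ} {v} i e b = exec assign (update-register v ρ i _) (s≤s (cost-bound (get b) e))

  set-rest : ∀ {S ρ} {v : Vec Tree n} x e → Bounded S ⟨ v ∣ ρ ⟩ →
             Exec O {m} ((n + x) ≔ e) ⟨ v ∣ ρ ⟩ ⟨ v ∣ ρ [ x ↦ eval e (store ⟨ v ∣ ρ ⟩) ] ⟩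
               (con 1 ⊕ costP e) S
  set-rest {ρ = ρ} {v} x e b = exec assign (update-rest v ρ x _) (s≤s (cost-bound (get b) e))

store-cong : ∀ {n} (v : Vec Tree n) {ρ ρ′} → ρ ≗ₛ ρ′ → store ⟨ v ∣ ρ ⟩ ≗ₛ store ⟨ v ∣ ρ′ ⟩
store-cong []      eq x       = eq x
store-cong (a ∷ v) eq zero    = refl
store-cong (a ∷ v) eq (suc x) = store-cong v eq x

exec-rest-≗ : ∀ {O m n} {p : Program m} {γ : Config n} {v : Vec Tree n} {ρ ρ′ P S} → ρ ≗ₛ ρ′ →
              Exec O p γ ⟨ v ∣ ρ ⟩ P S → Exec O p γ ⟨ v ∣ ρ′ ⟩ P S
exec-rest-≗ {v = v} eq = exec-≗ (store-cong v eq)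

-- Relocating a program to later variables

shiftExpr : ℕ → Expr → Expr
shiftExpr n (var x)    = var (n + x)
shiftExpr n (quot a)   = quot a
shiftExpr n (cons e f) = cons (shiftExpr n e) (shiftExpr n f)
shiftExpr n (hd e)     = hd (shiftExpr n e)
shiftExpr n (tl e)     = tl (shiftExpr n e)

shift : ∀ {m} → ℕ → Program plain → Program m
shift n (x ≔ e)      = (n + x) ≔ shiftExpr n e
shift n (p ⨟ q)      = shift n p ⨟ shift n q
shift n (cond e p q) = cond (shiftExpr n e) (shift n p) (shift n q)
shift n (while e p)  = while (shiftExpr n e) (shift n p)

module _ {n} (v : Vec Tree n) where

  eval-shift : ∀ e ρ → eval (shiftExpr n e) (store ⟨ v ∣ ρ ⟩) ≡ eval e ρ
  eval-shift (var x)    ρ = lookup-rest v ρ x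
  eval-shift (quot a)   ρ = refl
  eval-shift (cons e f) ρ = cong₂ _∙_ (eval-shift e ρ) (eval-shift f ρ)
  eval-shift (hd e)     ρ = cong head (eval-shift e ρ)
  eval-shift (tl e)     ρ = cong tail (eval-shift e ρ)

  cost-shift : ∀ e ρ → cost (shiftExpr n e) (store ⟨ v ∣ ρ ⟩) ≡ cost e ρ
  cost-shift (var x)    ρ = cong size (lookup-rest v ρ x)
  cost-shift (quot a)   ρ = refl
  cost-shift (cons e f) ρ = cong₂ _+_ (cong₂ _+_ (cost-shift e ρ) (cost-shift f ρ))
                                      (cong size (eval-shift (cons e f) ρ))
  cost-shift (hd e)     ρ = cong₂ _+_ (cost-shift e ρ) (cong size (eval-shift (hd e) ρ))
  cost-shift (tl e)     ρ = cong₂ _+_ (cost-shift e ρ) (cong size (eval-shift (tl e) ρ))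

  -- Only variables are renamed, so the time is unchanged. A plain program has no `ask` step, which
  -- leaves oracle and mode free: the verifier can run inside the rule and inside the reduction.
  run-shift : ∀ {O O′ m} {p : Program plain} {ρ ρ′ t} → Run O′ p ρ ρ′ t →
              ∀ {σ} → σ ≗ₛ store ⟨ v ∣ ρ ⟩ →
              ∃[ σ′ ] Run O {m} (shift n p) σ σ′ t × σ′ ≗ₛ store ⟨ v ∣ ρ′ ⟩
  run-shift {ρ = ρ} (assign {x = x} {e}) {σ} eq
    rewrite sym (cost-shift e ρ) | sym (cost-cong (shiftExpr n e) eq) =
    _ , assign , λ y → trans
      (update-cong (n + x) eq (trans (eval-cong (shiftExpr n e) eq) (eval-shift e ρ)) y)
      (update-rest v ρ x (eval e ρ) y)
  run-shift (seq r s) eq with run-shift r eq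
  ... | _ , r′ , eq′ with run-shift s eq′
  ... | _ , s′ , eq″ = _ , seq r′ s′ , eq″
  run-shift {ρ = ρ} (cond-t {e = e} t r) eq with run-shift r eq
  ... | _ , r′ , eq′ rewrite sym (cost-shift e ρ) | sym (cost-cong (shiftExpr n e) eq) =
    _ , cond-t (trans (eval-cong (shiftExpr n e) eq) (trans (eval-shift e ρ) t)) r′ , eq′
  run-shift {ρ = ρ} (cond-f {e = e} t r) eq with run-shift r eq
  ... | _ , r′ , eq′ rewrite sym (cost-shift e ρ) | sym (cost-cong (shiftExpr n e) eq) =
    _ , cond-f (trans (eval-cong (shiftExpr n e) eq) (trans (eval-shift e ρ) t)) r′ , eq′
  run-shift {ρ = ρ} (stop {e = e} t) eq
    rewrite sym (cost-shift e ρ) | sym (cost-cong (shiftExpr n e) eq) =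
    _ , stop (trans (eval-cong (shiftExpr n e) eq) (trans (eval-shift e ρ) t)) , eq
  run-shift {ρ = ρ} (step {e = e} t r s) eq with run-shift r eq
  ... | _ , r′ , eq′ with run-shift s eq′
  ... | _ , s′ , eq″ rewrite sym (cost-shift e ρ) | sym (cost-cong (shiftExpr n e) eq) =
    _ , step (trans (eval-cong (shiftExpr n e) eq) (trans (eval-shift e ρ) t)) r′ s′ , eq″

-- Unary arithmetic

-- Of the six registers, 0 holds the second operand, 1 the input word, 2 the
-- first operand and the result, and 3 and 4 the loop counters.

-- Reads any tree as a unary number, so that the encoded input word can itself serve as the number
-- `length x`.
spine : Tree → ℕ
spine nil     = 0
spine (_ ∙ b) = suc (spine b)

pad : ℕ → Tree → Tree
pad zero    a = a
pad (suc n) a = pad n (nil ∙ a)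

spine≤size : ∀ a → spine a ≤ size a
spine≤size nil     = z≤n
spine≤size (a ∙ b) = s≤s (≤-trans (spine≤size b) (m≤n+m _ (size a)))

spine-unary : ∀ n → spine (encUnary n) ≡ n
spine-unary zero    = refl
spine-unary (suc n) = cong suc (spine-unary n)

spine-word : ∀ x → spine (encWord x) ≡ length x
spine-word []      = refl
spine-word (_ ∷ x) = cong suc (spine-word x)

pad-unary : ∀ n k → pad n (encUnary k) ≡ encUnary (n + k)
pad-unary zero    k = refl
pad-unary (suc n) k = trans (pad-unary n (suc k)) (cong encUnary (+-suc n k))

pad-+ : ∀ m n a → pad (m + n) a ≡ pad n (pad m a)
pad-+ zero    n a = refl
pad-+ (suc m) n a = pad-+ m n (nil ∙ a)

+-double-suc : ∀ a n → 2 + a + 2 * n ≡ a + 2 * suc n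
+-double-suc = solve-∀

size-pad : ∀ n a → size (pad n a) ≡ size a + 2 * n
size-pad zero    a = sym (+-identityʳ (size a))
size-pad (suc n) a = trans (size-pad n (nil ∙ a)) (+-double-suc (size a) n)

addLoop add mulLoop mul : ∀ {m} → Program m
addLoop = while (var 3) (2 ≔ cons (quot nil) (var 2) ⨟ 3 ≔ tl (var 3))
add     = 3 ≔ var 0 ⨟ addLoop
mulLoop = while (var 4) (add ⨟ 4 ≔ tl (var 4))
mul     = 4 ≔ var 2 ⨟ 2 ≔ quot nil ⨟ mulLoop

addLoopP addP mulLoopP mulP : Poly
addLoopP = loopP (var 3) (con 1 ⊕ ((con 1 ⊕ costP (cons (quot nil) (var 2)))
           ⊕ (con 1 ⊕ costP (tl (var 3)))))
addP     = con 1 ⊕ ((con 1 ⊕ costP (var 0)) ⊕ (con 1 ⊕ X) ⊗ addLoopP)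
mulLoopP = loopP (var 4) (con 1 ⊕ (addP ⊕ (con 1 ⊕ costP (tl (var 4)))))
mulP     = con 1 ⊕ ((con 1 ⊕ costP (var 2)) ⊕ (con 1 ⊕ ((con 1 ⊕ costP (quot nil))
           ⊕ ((con 1 ⊕ X) ⊗ mulLoopP) ⊚ (X ⊕ con 2 ⊗ (X ⊗ X)))))

module _ {O : Oracle} {m : Mode} {ρ : Store} where

  -- The second hypothesis is a loop invariant: each pass adds 2 to the size of `acc` and takes 1
  -- from the spine of `j`. One bound `M` thus holds for all passes, whereas bounds derived pass by
  -- pass would compound.
  exec-addLoop : ∀ j {x a acc i y M} → Bounded M ⟨ x ∷ a ∷ acc ∷ j ∷ i ∷ y ∷ [] ∣ ρ ⟩ →
    size acc + 2 * spine j ≤ M →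
    Exec O {m} addLoop ⟨ x ∷ a ∷ acc ∷ j ∷ i ∷ y ∷ [] ∣ ρ ⟩
      ⟨ x ∷ a ∷ pad (spine j) acc ∷ nil ∷ i ∷ y ∷ [] ∣ ρ ⟩
      (con (suc (spine j)) ⊗ addLoopP) M
  exec-addLoop nil     b _ = exec-stop b refl
  exec-addLoop (c ∙ j) {x} {a} {acc} {i} {y} {M} b h =
    exec-step b refl (set 2F _ b ⨾ set 3F _ b₁) (exec-addLoop j b₂ h′)
    where
    h′ : 2 + size acc + 2 * spine j ≤ M
    h′ = ≤-trans (≤-reflexive (+-double-suc (size acc) (spine j))) h
    b₁ : Bounded M ⟨ x ∷ a ∷ (nil ∙ acc) ∷ (c ∙ j) ∷ i ∷ y ∷ [] ∣ ρ ⟩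
    b₁ = bounded-set 2F b (≤-trans (m≤m+n _ (2 * spine j)) h′)
    b₂ : Bounded M ⟨ x ∷ a ∷ (nil ∙ acc) ∷ j ∷ i ∷ y ∷ [] ∣ ρ ⟩
    b₂ = bounded-set 3F b₁ (≤-trans (size-tail (c ∙ j)) (get b 3))

  exec-add : ∀ {x a acc j i y M} → Bounded M ⟨ x ∷ a ∷ acc ∷ j ∷ i ∷ y ∷ [] ∣ ρ ⟩ →
    size acc + 2 * spine x ≤ M →
    Exec O {m} add ⟨ x ∷ a ∷ acc ∷ j ∷ i ∷ y ∷ [] ∣ ρ ⟩
      ⟨ x ∷ a ∷ pad (spine x) acc ∷ nil ∷ i ∷ y ∷ [] ∣ ρ ⟩ addP M
  exec-add {x} {M = M} b h = set 3F _ b ⨾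
    weaken (*-monoˡ-≤ (⟦ addLoopP ⟧ M) (s≤s (≤-trans (spine≤size x) (get b 0))))
      (exec-addLoop x (bounded-set 3F b (get b 0)) h)

  exec-mulLoop : ∀ i {x a acc y M} → Bounded M ⟨ x ∷ a ∷ acc ∷ nil ∷ i ∷ y ∷ [] ∣ ρ ⟩ →
    size acc + 2 * (spine i * spine x) ≤ M →
    Exec O {m} mulLoop ⟨ x ∷ a ∷ acc ∷ nil ∷ i ∷ y ∷ [] ∣ ρ ⟩
      ⟨ x ∷ a ∷ pad (spine i * spine x) acc ∷ nil ∷ nil ∷ y ∷ [] ∣ ρ ⟩
      (con (suc (spine i)) ⊗ mulLoopP) M
  exec-mulLoop nil     b _ = exec-stop b refl
  exec-mulLoop (c ∙ i) {x} {a} {acc} {y} {M} b h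
    rewrite pad-+ (spine x) (spine i * spine x) acc =
    exec-step b refl (exec-add b h₁ ⨾ set 4F _ b₁)
      (exec-mulLoop i b₂ (≤-trans (≤-reflexive h₂) h))
    where
    distrib : ∀ a m n → a + 2 * m + 2 * n ≡ a + 2 * (m + n)
    distrib = solve-∀
    h₂ : size (pad (spine x) acc) + 2 * (spine i * spine x) ≡ size acc + 2 * (spine x + spine i * spine x)
    h₂ = trans (cong (_+ 2 * (spine i * spine x)) (size-pad (spine x) acc))
               (distrib (size acc) (spine x) (spine i * spine x))
    h₁ : size acc + 2 * spine x ≤ M
    h₁ = ≤-trans (+-monoʳ-≤ (size acc) (*-monoʳ-≤ 2 (m≤m+n (spine x) (spine i * spine x)))) h
    b₁ : Bounded M ⟨ x ∷ a ∷ pad (spine x) acc ∷ nil ∷ (c ∙ i) ∷ y ∷ [] ∣ ρ ⟩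
    b₁ = bounded-set 2F b (≤-trans (≤-reflexive (size-pad (spine x) acc)) h₁)
    b₂ : Bounded M ⟨ x ∷ a ∷ pad (spine x) acc ∷ nil ∷ i ∷ y ∷ [] ∣ ρ ⟩
    b₂ = bounded-set 4F b₁ (≤-trans (size-tail (c ∙ i)) (get b 4))

  exec-mul : ∀ {x a acc y S} → Bounded S ⟨ x ∷ a ∷ acc ∷ nil ∷ nil ∷ y ∷ [] ∣ ρ ⟩ →
    Exec O {m} mul ⟨ x ∷ a ∷ acc ∷ nil ∷ nil ∷ y ∷ [] ∣ ρ ⟩
      ⟨ x ∷ a ∷ encUnary (spine acc * spine x) ∷ nil ∷ nil ∷ y ∷ [] ∣ ρ ⟩ mulP S
  exec-mul {x} {a} {acc} {y} {S} b
    rewrite sym (trans (pad-unary (spine acc * spine x) 0) (cong encUnary (+-identityʳ _))) =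
    set 4F _ b ⨾ set 2F _ b₁ ⨾
    weaken {S = M} (*-monoˡ-≤ (⟦ mulLoopP ⟧ M) (s≤s (≤-trans sa≤S S≤M)))
      (exec-mulLoop acc (bounded-weaken S≤M b₂)
        (+-mono-≤ (get b 3) (*-monoʳ-≤ 2 (*-mono-≤ sa≤S sx≤S))))
    where
    -- Both spines are at most `S`, and each unit of the product adds 2 to the size of the
    -- accumulator.
    M = S + 2 * (S * S)
    S≤M : S ≤ M
    S≤M = m≤m+n S _
    sa≤S : spine acc ≤ S
    sa≤S = ≤-trans (spine≤size acc) (get b 2)
    sx≤S : spine x ≤ S
    sx≤S = ≤-trans (spine≤size x) (get b 0)
    b₁ : Bounded S ⟨ x ∷ a ∷ acc ∷ nil ∷ acc ∷ y ∷ [] ∣ ρ ⟩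
    b₁ = bounded-set 4F b (get b 2)
    b₂ : Bounded S ⟨ x ∷ a ∷ nil ∷ nil ∷ acc ∷ y ∷ [] ∣ ρ ⟩
    b₂ = bounded-set 2F b₁ (get b 3)

power : ∀ {m} → ℕ → Program m
power zero    = 2 ≔ quot (encUnary 1)
power (suc k) = power k ⨟ mul

powerP : ℕ → Poly
powerP zero    = con 1 ⊕ costP (quot (encUnary 1))
powerP (suc k) = con 1 ⊕ (powerP k ⊕ mulP ⊚ (X ⊕ powerP k))

polynomial : ∀ {m} → ℕ → Program m
polynomial k = 0 ≔ var 1 ⨟ power k ⨟ 0 ≔ quot (encUnary k) ⨟ mul ⨟ add

module _ {O : Oracle} {m : Mode} {ρ : Store} where

  exec-power : ∀ k {x a acc y S} → Bounded S ⟨ x ∷ a ∷ acc ∷ nil ∷ nil ∷ y ∷ [] ∣ ρ ⟩ →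
    Exec O {m} (power k) ⟨ x ∷ a ∷ acc ∷ nil ∷ nil ∷ y ∷ [] ∣ ρ ⟩
      ⟨ x ∷ a ∷ encUnary (spine x ^ k) ∷ nil ∷ nil ∷ y ∷ [] ∣ ρ ⟩ (powerP k) S
  exec-power zero b = set 2F _ b
  exec-power (suc k) {x = x} b
    rewrite trans (*-comm (spine x) (spine x ^ k))
                  (cong (_* spine x) (sym (spine-unary (spine x ^ k)))) =
    r ⨾ᵇ exec-mul (exec-bounded r b)
    where r = exec-power k b

abstract
  -- The bound is fixed before the store is given and is left to unification. Registers 3 and 4 end
  -- as `nil`, as they began, so the construction can be run again for another exponent.
  exec-polynomial : ∀ k → ∃[ P ] (∀ {O m ρ x a acc y S} →
    Bounded S ⟨ x ∷ a ∷ acc ∷ nil ∷ nil ∷ y ∷ [] ∣ ρ ⟩ →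
    Exec O {m} (polynomial k) ⟨ x ∷ a ∷ acc ∷ nil ∷ nil ∷ y ∷ [] ∣ ρ ⟩
      ⟨ encUnary k ∷ a ∷ encUnary (poly k (spine a)) ∷ nil ∷ nil ∷ y ∷ [] ∣ ρ ⟩ P S)
  exec-polynomial k = _ , λ {_} {_} {ρ} {x} {a} {acc} {y} b →
    let r₁ = set 0F (var 1) b
        b₁ = exec-bounded r₁ b
        r₂ = exec-power k b₁
        b₂ = exec-bounded r₂ b₁
        r₃ = set 0F (quot (encUnary k)) b₂
        b₃ = exec-bounded r₃ b₂
        r₄ = exec-mul b₃
        b₄ = exec-bounded r₄ b₃
        r₅ = exec-add-poly b₄
    in exec-≗ (λ z → cong (λ t → store ⟨ encUnary k ∷ a ∷ t ∷ nil ∷ nil ∷ y ∷ [] ∣ ρ ⟩ z)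
                 (value (spine a)))
         (r₁ ⨾ᵇ r₂ ⨾ᵇ r₃ ⨾ᵇ r₄ ⨾ᵇ r₅)
    where
    exec-add-poly : ∀ {O m ρ x a acc y S} → Bounded S ⟨ x ∷ a ∷ acc ∷ nil ∷ nil ∷ y ∷ [] ∣ ρ ⟩ →
      Exec O {m} add ⟨ x ∷ a ∷ acc ∷ nil ∷ nil ∷ y ∷ [] ∣ ρ ⟩
        ⟨ x ∷ a ∷ pad (spine x) acc ∷ nil ∷ nil ∷ y ∷ [] ∣ ρ ⟩ (addP ⊚ (X ⊕ con 2 ⊗ X)) S
    exec-add-poly {x = x} {S = S} b with exec-add {x = x} (bounded-weaken (m≤m+n S (2 * S)) b)
      (+-mono-≤ (get b 2) (*-monoʳ-≤ 2 (≤-trans (spine≤size x) (get b 0))))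
    ... | exec r eq t≤ = exec r eq t≤
    value : ∀ n → pad (spine (encUnary k)) (encUnary (spine (encUnary (n ^ k)) * spine (encUnary k)))
                  ≡ encUnary (poly k n)
    value n rewrite spine-unary k | spine-unary (n ^ k) | pad-unary k (n ^ k * k) =
      cong encUnary (trans (+-comm k _) (cong (_+ k) (*-comm (n ^ k) k)))

-- Walks on a graph with a single edge

G : BuildingGraph 1
G = record
  { |V|            = 2
  ; |E|            = 1
  ; ends           = λ _ → 0F , 1F
  ; EX             = outside ∷ inside ∷ []
  ; c              = λ _ → 1ℤ
  ; d              = λ { (inj₁ _) → 0ℤ ; (inj₂ _) → 1ℤ }
  ; ends-injective = λ { {0F} {0F} _ → refl }
  ; EX-proper      = (λ { (there here) → there here }) , 0F , here , λ ()
  ; d-vertex       = λ _ → refl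
  ; c-exit         = λ _ _ → +≤+ (s≤s z≤n)
  }

open BuildingGraph G

pattern origin   = inj₁ 0F ∷ []
pattern exit     = inj₁ 1F ∷ []
pattern corridor = inj₂ 0F ∷ []

States : Set
States = List (Vec Location 1)

encPlace : Vec Location 1 → Tree
encPlace = encVec encLocation

encStates : States → Tree
encStates = encList encPlace

-- The word spelled by a walk, last letter first: waiting at the origin is 0,
-- being on the edge is 1, and being at the exit is no letter.
collect : Word → States → Word
collect y []              = y
collect y (origin   ∷ ss) = collect (false ∷ y) ss
collect y (exit     ∷ ss) = collect y ss
collect y (corridor ∷ ss) = collect (true ∷ y) ss

-- The state at time 0 is prescribed and carries no letter.
decode : States → Word
decode ss = collect [] (drop 1 ss)

collect-∷ : ∀ y s ss → collect (collect y (s ∷ [])) ss ≡ collect y (s ∷ ss)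
collect-∷ y origin   ss = refl
collect-∷ y exit     ss = refl
collect-∷ y corridor ss = refl

-- The constant 6 is what one more `origin` adds to the idle schedule; a letter adds at most 4.
-- Sharing it gives both registers the same invariant in `exec-scan`.
size-collect : ∀ y s → size (encWord (collect y (s ∷ []))) ≤ 6 + size (encWord y)
size-collect y origin   = m≤n+m _ 4
size-collect y exit     = m≤n+m _ 6
size-collect y corridor = m≤n+m _ 2

-- Decoding a schedule by a program

stay : ℕ → Tree → Tree
stay zero    a = a
stay (suc n) a = stay n (encPlace origin ∙ a)

length≤size : ∀ {A : Set} (enc : A → Tree) xs → length xs ≤ size (encList enc xs)
length≤size enc []       = z≤n
length≤size enc (x ∷ xs) = s≤s (≤-trans (length≤size enc xs) (m≤n+m _ (size (enc x))))

-- A state encodes as location ∙ nil and a location as tag ∙ index; the tag of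
-- an edge is encBool true, and only the exit has a nonzero index.
here-location : Expr
here-location = hd (hd (var 3))

-- The tag of a location is already the code of its letter and is pushed unchanged; at the exit,
-- `2 ≔ var 2` acts as a skip.
letter : ∀ {m} → Program m
letter = cond (tl here-location) (2 ≔ var 2) (2 ≔ cons (hd here-location) (var 2))

scan : ∀ {m} → Program m
scan = while (var 3)
  (5 ≔ cons (quot (encPlace origin)) (var 5) ⨟ letter ⨟ 3 ≔ tl (var 3))

letterP scanStepP scanP : Poly
letterP   = con 1 ⊕ (costP (tl here-location)
            ⊕ ((con 1 ⊕ costP (var 2)) ⊕ (con 1 ⊕ costP (cons (hd here-location) (var 2)))))
scanStepP = con 1 ⊕ ((con 1 ⊕ costP (cons (quot (encPlace origin)) (var 5)))
            ⊕ (con 1 ⊕ (letterP ⊕ (con 1 ⊕ costP (tl (var 3))))))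
scanP     = (con 1 ⊕ X) ⊗ loopP (var 3) scanStepP

module _ {O : Oracle} {m : Mode} {ρ : Store} where

  exec-letter : ∀ s ss {z x y i w M} →
    Bounded M ⟨ z ∷ x ∷ encWord y ∷ encStates (s ∷ ss) ∷ i ∷ w ∷ [] ∣ ρ ⟩ →
    Exec O {m} letter ⟨ z ∷ x ∷ encWord y ∷ encStates (s ∷ ss) ∷ i ∷ w ∷ [] ∣ ρ ⟩
      ⟨ z ∷ x ∷ encWord (collect y (s ∷ [])) ∷ encStates (s ∷ ss) ∷ i ∷ w ∷ [] ∣ ρ ⟩ letterP M
  exec-letter origin ss {M = M} b =
    exec-cond-f b refl (weaken (m≤n+m _ (⟦ con 1 ⊕ costP (var 2) ⟧ M))
      (set 2F (cons (hd here-location) (var 2)) b))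
  exec-letter exit ss b =
    exec-cond-t b refl (weaken (m≤m+n _ _) (set 2F (var 2) b))
  exec-letter corridor ss {M = M} b =
    exec-cond-f b refl (weaken (m≤n+m _ (⟦ con 1 ⊕ costP (var 2) ⟧ M))
      (set 2F (cons (hd here-location) (var 2)) b))

  exec-scan : ∀ ss {z x i w y M} →
    Bounded M ⟨ z ∷ x ∷ encWord y ∷ encStates ss ∷ i ∷ w ∷ [] ∣ ρ ⟩ →
    size (encWord y) + 6 * length ss ≤ M → size w + 6 * length ss ≤ M →
    Exec O {m} scan ⟨ z ∷ x ∷ encWord y ∷ encStates ss ∷ i ∷ w ∷ [] ∣ ρ ⟩
      ⟨ z ∷ x ∷ encWord (collect y ss) ∷ nil ∷ i ∷ stay (length ss) w ∷ [] ∣ ρ ⟩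
      (con (suc (length ss)) ⊗ loopP (var 3) scanStepP) M
  exec-scan []       b _ _ = exec-stop b refl
  exec-scan (s ∷ ss) {z} {x} {i} {w} {y} {M} b hy hw rewrite sym (collect-∷ y s ss) =
    exec-step b refl (set 5F _ b ⨾ exec-letter s ss b₁ ⨾ set 3F _ b₂) (exec-scan ss b₃ hy′ hw′)
    where
    6+ : ∀ a n → 6 + a + 6 * n ≡ a + 6 * suc n
    6+ = solve-∀
    hw′ : 6 + size w + 6 * length ss ≤ M
    hw′ = ≤-trans (≤-reflexive (6+ (size w) (length ss))) hw
    hy′ : size (encWord (collect y (s ∷ []))) + 6 * length ss ≤ M
    hy′ = ≤-trans (+-monoˡ-≤ (6 * length ss) (size-collect y s))
            (≤-trans (≤-reflexive (6+ (size (encWord y)) (length ss))) hy)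
    b₁ : Bounded M ⟨ z ∷ x ∷ encWord y ∷ encStates (s ∷ ss) ∷ i ∷ (encPlace origin ∙ w) ∷ [] ∣ ρ ⟩
    b₁ = bounded-set 5F b (≤-trans (m≤m+n _ _) hw′)
    b₂ : Bounded M ⟨ z ∷ x ∷ encWord (collect y (s ∷ [])) ∷ encStates (s ∷ ss) ∷ i
                     ∷ (encPlace origin ∙ w) ∷ [] ∣ ρ ⟩
    b₂ = bounded-set 2F b₁ (≤-trans (m≤m+n _ _) hy′)
    b₃ : Bounded M ⟨ z ∷ x ∷ encWord (collect y (s ∷ [])) ∷ encStates ss ∷ i
                     ∷ (encPlace origin ∙ w) ∷ [] ∣ ρ ⟩
    b₃ = bounded-set 3F b₂ (≤-trans (size-tail (encStates (s ∷ ss))) (get b 3))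

  exec-scan-poly : ∀ ss {z x i w y S} →
    Bounded S ⟨ z ∷ x ∷ encWord y ∷ encStates ss ∷ i ∷ w ∷ [] ∣ ρ ⟩ →
    Exec O {m} scan ⟨ z ∷ x ∷ encWord y ∷ encStates ss ∷ i ∷ w ∷ [] ∣ ρ ⟩
      ⟨ z ∷ x ∷ encWord (collect y ss) ∷ nil ∷ i ∷ stay (length ss) w ∷ [] ∣ ρ ⟩
      (scanP ⊚ (X ⊕ con 6 ⊗ X)) S
  exec-scan-poly ss {S = S} b =
    weaken {S = M} (*-monoˡ-≤ (⟦ loopP (var 3) scanStepP ⟧ M) (s≤s (≤-trans len≤S (m≤m+n S _))))
      (exec-scan ss (bounded-weaken (m≤m+n S _) b)
        (+-mono-≤ (get b 2) (*-monoʳ-≤ 6 len≤S)) (+-mono-≤ (get b 5) (*-monoʳ-≤ 6 len≤S)))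
    where
    M = S + 6 * S
    len≤S : length ss ≤ S
    len≤S = ≤-trans (length≤size _ ss) (get b 3)

-- Running the verifier on a decoded schedule

blank : Store
blank _ = nil

-- The variables from 6 on stay `nil` until the verifier's input is put into variable 6, so the
-- verifier finds exactly its initial store.
initial-blank : ∀ a → blank [ 0 ↦ a ] ≗ₛ initial a
initial-blank a zero    = refl
initial-blank a (suc _) = refl

module _ {L : Language} (np : NP L) where
  open NP np

  -- Variables 0 to 5 belong to the scan: 0 holds the schedule, 1 the input, 2 the
  -- word being decoded, and 5 the idle schedule, built alongside.  The verifier
  -- gets variables 6, 7, ….
  judge : ∀ {m} → Program m
  judge = 3 ≔ tl (var 0) ⨟ 2 ≔ quot nil ⨟ 5 ≔ quot (encStates (origin ∷ [])) ⨟ scan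
        ⨟ 6 ≔ cons (var 1) (var 2) ⨟ shift 6 verifier

  exec-verifier : ∀ {O m} x y {z j i w S} →
    Bounded S ⟨ z ∷ encWord x ∷ encWord y ∷ j ∷ i ∷ w ∷ [] ∣ initial (encWord x ∙ encWord y) ⟩ →
    ∃[ ρ ] ρ 0 ≡ encBool (accepts x y) ×
      Exec O {m} (shift 6 verifier)
        ⟨ z ∷ encWord x ∷ encWord y ∷ j ∷ i ∷ w ∷ [] ∣ initial (encWord x ∙ encWord y) ⟩
        ⟨ z ∷ encWord x ∷ encWord y ∷ j ∷ i ∷ w ∷ [] ∣ ρ ⟩
        ((con degree ⊗ X ↑ degree ⊕ con degree) ⊚ (X ⊕ X)) S
  exec-verifier x y {z} {j} {i} {w} b with runs x y
  ... | ρ , t , r , ρ0≡ , t≤ with run-shift (z ∷ encWord x ∷ encWord y ∷ j ∷ i ∷ w ∷ []) r (λ _ → refl)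
  ... | _ , r′ , eq = ρ , ρ0≡ , exec r′ eq (≤-trans t≤
    (⟦⟧-mono (con degree ⊗ X ↑ degree ⊕ con degree)
      (+-mono-≤ (≤-trans (length≤size _ x) (get b 1)) (≤-trans (length≤size _ y) (get b 2)))))

  tail-states : ∀ ss → tail (encStates ss) ≡ encStates (drop 1 ss)
  tail-states []       = refl
  tail-states (_ ∷ ss) = refl

  abstract
    exec-judge : ∃[ P ] (∀ {O m} x ss {y j i w S} →
      Bounded S ⟨ encStates ss ∷ encWord x ∷ y ∷ j ∷ i ∷ w ∷ [] ∣ blank ⟩ →
      ∃[ ρ ] ρ 0 ≡ encBool (accepts x (decode ss)) ×
        Exec O {m} judge ⟨ encStates ss ∷ encWord x ∷ y ∷ j ∷ i ∷ w ∷ [] ∣ blank ⟩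
          ⟨ encStates ss ∷ encWord x ∷ encWord (decode ss) ∷ nil ∷ i
            ∷ stay (length (drop 1 ss)) (encStates (origin ∷ [])) ∷ [] ∣ ρ ⟩ P S)
    exec-judge = _ , λ {O} {m} x ss {y} {j} {i} {w} {S} b →
      let r₁ = subst (λ t → Exec O {m} _
                   ⟨ encStates ss ∷ encWord x ∷ y ∷ j ∷ i ∷ w ∷ [] ∣ blank ⟩
                   ⟨ encStates ss ∷ encWord x ∷ y ∷ t ∷ i ∷ w ∷ [] ∣ blank ⟩ _ S)
                 (tail-states ss) (set 3F (tl (var 0)) b)
          b₁ = exec-bounded r₁ b
          r₂ = set 2F (quot nil) b₁
          b₂ = exec-bounded r₂ b₁
          r₃ = set 5F (quot (encStates (origin ∷ []))) b₂
          b₃ = exec-bounded r₃ b₂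
          r₄ = exec-scan-poly (drop 1 ss) {y = []} b₃
          b₄ = exec-bounded r₄ b₃
          r₅ = exec-rest-≗ (initial-blank _) (set-rest 0 (cons (var 1) (var 2)) b₄)
          b₅ = exec-bounded r₅ b₄
          ρ , ρ0≡ , r₆ = exec-verifier x (decode ss) b₅
      in ρ , ρ0≡ , (r₁ ⨾ᵇ r₂ ⨾ᵇ r₃ ⨾ᵇ r₄ ⨾ᵇ r₅ ⨾ᵇ r₆)

  dirac : Var → Expr
  dirac x = cons (cons (var x) (quot (encℚ 1ℚ))) (quot nil)

  answer : Program plain
  answer = judge ⨟ cond (var 6) (0 ≔ dirac 0) (0 ≔ dirac 5)

  rule : Word → Program plain
  rule x = 1 ≔ quot (encWord x) ⨟ answer

  ruled : Word → States → Tree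
  ruled x ss = if accepts x (decode ss) then encStates ss
               else stay (length (drop 1 ss)) (encStates (origin ∷ []))

  abstract
    exec-rule : ∃[ P ] (∀ {O} x ss {S} → size (encWord x) ≤ S →
      Bounded S ⟨ encStates ss ∷ nil ∷ nil ∷ nil ∷ nil ∷ nil ∷ [] ∣ blank ⟩ →
      ∃[ δ ] store δ 0 ≡ (ruled x ss ∙ encℚ 1ℚ) ∙ nil ×
        Exec O {n = 6} (rule x) ⟨ encStates ss ∷ nil ∷ nil ∷ nil ∷ nil ∷ nil ∷ [] ∣ blank ⟩ δ P S)
    exec-rule = _ , λ {O} x ss {S} x≤S b →
      -- `costP` counts a quoted word as a constant, which would make the bound depend on `x`; `x≤S`
      -- trades it for the variable `X`.
      let r₁ = weaken {Q = con 1 ⊕ X} {S′ = S} (s≤s x≤S) (set 1F (quot (encWord x)) b)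
          b₁ = exec-bounded r₁ b
          ρ , ρ0≡ , r₂ = proj₂ exec-judge x ss b₁
          b₂ = exec-bounded r₂ b₁
          δ , δ0≡ , r₃ = branch x ss ρ0≡ b₂
      in δ , δ0≡ , (r₁ ⨾ᵇ r₂ ⨾ᵇ r₃)
      where
      branch : ∀ {O} x ss {y j i ρ S} → ρ 0 ≡ encBool (accepts x (decode ss)) →
        Bounded S ⟨ encStates ss ∷ encWord x ∷ y ∷ j ∷ i
                    ∷ stay (length (drop 1 ss)) (encStates (origin ∷ [])) ∷ [] ∣ ρ ⟩ →
        ∃[ δ ] store δ 0 ≡ (ruled x ss ∙ encℚ 1ℚ) ∙ nil ×
          Exec O {plain} {6} (cond (var 6) (0 ≔ dirac 0) (0 ≔ dirac 5))
            ⟨ encStates ss ∷ encWord x ∷ y ∷ j ∷ i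
              ∷ stay (length (drop 1 ss)) (encStates (origin ∷ [])) ∷ [] ∣ ρ ⟩ δ
            (con 1 ⊕ (costP (var 6) ⊕ (con 1 ⊕ costP (dirac 0)))) S
      branch x ss eq b with accepts x (decode ss)
      ... | true  = _ , refl , exec-cond-t b eq (set 0F (dirac 0) b)
      ... | false = _ , refl , exec-cond-f b eq (set 0F (dirac 5) b)

-- Words as walks, and sizes of encodings

exit-only : ∀ {ℓ} → AtExit ℓ → ℓ ≡ inj₁ 1F
exit-only {inj₁ 1F} _ = refl

joined-distinct : ∀ e v → ¬ Joins e v v
joined-distinct e v (inj₁ ())
joined-distinct e v (inj₂ ())

walk : Word → ℕ → Location
walk []          i       = inj₁ 1F
walk (false ∷ w) zero    = inj₁ 0F
walk (true ∷ w)  zero    = inj₂ 0F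
walk (_ ∷ w)     (suc i) = walk w i

walk-absorbing : ∀ w {i j} → i ≤ j → walk w i ≡ inj₁ 1F → walk w j ≡ inj₁ 1F
walk-absorbing []          _         _  = refl
walk-absorbing (false ∷ w) z≤n       ()
walk-absorbing (true ∷ w)  z≤n       ()
walk-absorbing (false ∷ w) (s≤s i≤j) eq = walk-absorbing w i≤j eq
walk-absorbing (true ∷ w)  (s≤s i≤j) eq = walk-absorbing w i≤j eq

walk-ends : ∀ w {i} → length w ≤ i → walk w i ≡ inj₁ 1F
walk-ends []          _         = refl
walk-ends (false ∷ w) (s≤s w≤i) = walk-ends w w≤i
walk-ends (true ∷ w)  (s≤s w≤i) = walk-ends w w≤i

collect-exits : ∀ y n → collect y (toList (tabulate {n = n} λ _ → exit)) ≡ y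
collect-exits y zero    = refl
collect-exits y (suc n) = collect-exits y n

collect-walk : ∀ y w {n} → length w ≤ n →
               collect y (toList (tabulate {n = n} λ t → walk w (toℕ t) ∷ [])) ≡ w ʳ++ y
collect-walk y []          {n} _         = collect-exits y n
collect-walk y (false ∷ w)     (s≤s w≤n) = collect-walk (false ∷ y) w w≤n
collect-walk y (true ∷ w)      (s≤s w≤n) = collect-walk (true ∷ y) w w≤n

-- The last state is the exit and yields no letter, so at most `n` of the `n + 1` states do.
collect-short : ∀ y {n} (v : Vec (Vec Location 1) (suc n)) → lookup (lookup v (fromℕ n)) 0F ≡ inj₁ 1F →
                length (collect y (toList v)) ≤ length y + n
collect-short y {zero}  (exit ∷ []) _ = m≤m+n _ 0
collect-short y {suc n} (origin ∷ v) eq =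
  ≤-trans (collect-short (false ∷ y) v eq) (≤-reflexive (sym (+-suc _ n)))
collect-short y {suc n} (corridor ∷ v) eq =
  ≤-trans (collect-short (true ∷ y) v eq) (≤-reflexive (sym (+-suc _ n)))
collect-short y {suc n} (exit ∷ v) eq =
  ≤-trans (collect-short y v eq) (+-monoʳ-≤ (length y) (n≤1+n n))

stay-∙ : ∀ n a → stay n (encPlace origin ∙ a) ≡ encPlace origin ∙ stay n a
stay-∙ zero    a = refl
stay-∙ (suc n) a = stay-∙ n (encPlace origin ∙ a)

stay-replicate : ∀ n → stay n nil ≡ encVec encPlace (replicate n origin)
stay-replicate zero    = refl
stay-replicate (suc n) = trans (stay-∙ n nil) (cong (encPlace origin ∙_) (stay-replicate n))

size-schedule : ∀ {n} (v : Vec (Vec Location 1) n) → size (encVec encPlace v) ≤ 1 + 8 * n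
size-schedule []      = ≤-refl
size-schedule {suc n} (s ∷ v) =
  ≤-trans (s≤s (+-mono-≤ (size-state s) (size-schedule v))) (≤-reflexive (8+ n))
  where
  8+ : ∀ n → 1 + (7 + (1 + 8 * n)) ≡ 1 + 8 * suc n
  8+ = solve-∀
  size-state : ∀ s → size (encPlace s) ≤ 7
  size-state origin   = m≤n+m 5 2
  size-state exit     = ≤-refl
  size-state corridor = ≤-refl

size-word : ∀ x → size (encWord x) ≤ 1 + 4 * length x
size-word []      = ≤-refl
size-word (b ∷ x) = ≤-trans (s≤s (+-mono-≤ (size-bit b) (size-word x))) (≤-reflexive (4+ (length x)))
  where
  4+ : ∀ n → 1 + (3 + (1 + 4 * n)) ≡ 1 + 4 * suc n
  4+ = solve-∀
  size-bit : ∀ b → size (encBool b) ≤ 3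
  size-bit false = m≤n+m 1 2
  size-bit true  = ≤-refl

-- Schedules with final time m + 1

module _ (m : ℕ) where
  open Schedules (suc m) G

  -- The origin and the edge each have every location as a legal successor, and unit travel time
  -- only forbids being at both vertices at the same instant. What remains to be required is that
  -- the exit is never left.
  absorbing⇒WES : ∀ w →
    (∀ t t′ → toℕ t ≤ toℕ t′ → at w 0F t ≡ inj₁ 1F → at w 0F t′ ≡ inj₁ 1F) → IsWES w
  absorbing⇒WES w absorbing = record
    { from-vertex = from-vertex
    ; from-edge   = from-edge
    ; travel-time = travel-time
    ; exit-final  = λ { 0F t t′ t<t′ exited → let eq = exit-only exited in
                        trans (absorbing t t′ (<⇒≤ t<t′) eq) (sym eq) }
    }
    where
    from-vertex : ∀ p (t : Fin (suc m)) v₁ → at w p (inject₁ t) ≡ inj₁ v₁ →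
        at w p (suc t) ≡ inj₁ v₁
      ⊎ (∃[ e ] ∃[ v₂ ] Joins e v₁ v₂ × at w p (suc t) ≡ inj₂ e)
      ⊎ (∃[ e ] ∃[ v₂ ] Joins e v₁ v₂ × at w p (suc t) ≡ inj₁ v₂)
    from-vertex 0F t 1F eq =
      inj₁ (absorbing (inject₁ t) (suc t) (≤-trans (≤-reflexive (toℕ-inject₁ t)) (n≤1+n _)) eq)
    from-vertex 0F t 0F eq with at w 0F (suc t)
    ... | inj₁ 0F = inj₁ refl
    ... | inj₁ 1F = inj₂ (inj₂ (0F , 1F , inj₁ refl , refl))
    ... | inj₂ 0F = inj₂ (inj₁ (0F , 1F , inj₁ refl , refl))
    from-edge : ∀ p (t : Fin (suc m)) e v₁ v₂ → Joins e v₁ v₂ → at w p (inject₁ t) ≡ inj₂ e →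
      at w p (suc t) ≡ inj₂ e ⊎ at w p (suc t) ≡ inj₁ v₁ ⊎ at w p (suc t) ≡ inj₁ v₂
    from-edge 0F t 0F v₁ v₂ joins eq with at w 0F (suc t) | joins
    ... | inj₂ 0F | _         = inj₁ refl
    ... | inj₁ 0F | inj₁ refl = inj₂ (inj₁ refl)
    ... | inj₁ 1F | inj₁ refl = inj₂ (inj₂ refl)
    ... | inj₁ 0F | inj₂ refl = inj₂ (inj₂ refl)
    ... | inj₁ 1F | inj₂ refl = inj₂ (inj₁ refl)
    travel-time : ∀ p e v₁ v₂ (t t′ : Time) k → Joins e v₁ v₂ → toℕ t′ ≡ toℕ t + k →
      at w p t ≡ inj₁ v₁ → at w p t′ ≡ inj₁ v₂ → d (inj₂ e) ℤ.≤ ℤ.+ k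
    travel-time p e v₁ v₂ t t′ (suc k) _ _ _ _ = +≤+ (s≤s z≤n)
    -- At `k = 0` the two times coincide, so `v₁` and `v₂` are equal, but the only edge is not a
    -- loop.
    travel-time p e v₁ v₂ t t′ zero joins t′≡t eq₁ eq₂
      with toℕ-injective (trans t′≡t (+-identityʳ _))
    ... | refl with trans (sym eq₁) eq₂
    ... | refl = ⊥-elim (joined-distinct e v₁ joins)

  idle : Schedule
  idle = replicate (suc (suc m)) origin

  at-idle : ∀ t → at idle 0F t ≡ inj₁ 0F
  at-idle t = cong (λ s → lookup s 0F) (lookup-replicate t origin)

  idle-WES : IsWES idle
  idle-WES = absorbing⇒WES idle λ t _ _ eq → case trans (sym (at-idle t)) eq of λ ()

  -- The leading `false` is the origin at time 0, which `decode` drops; the word is reversed because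
  -- `collect` puts the last letter first.
  spell : Word → Schedule
  spell y = tabulate λ t → walk (false ∷ reverse y) (toℕ t) ∷ []

  at-spell : ∀ y t → at (spell y) 0F t ≡ walk (false ∷ reverse y) (toℕ t)
  at-spell y t = cong (λ s → lookup s 0F) (lookup∘tabulate (λ t → walk (false ∷ reverse y) (toℕ t) ∷ []) t)

  spell-SES : ∀ y → length y ≤ m → IsSES (spell y)
  spell-SES y y≤m = record
    { isWES     = absorbing⇒WES (spell y) λ t t′ t≤t′ eq →
        trans (at-spell y t′) (walk-absorbing (false ∷ reverse y) t≤t′ (trans (sym (at-spell y t)) eq))
    ; capacity  = λ t ℓ → +≤+ (count≤n (ℓ ≟ᴸ_) (lookup (spell y) t))
    ; evacuated = λ { 0F → subst AtExit (sym (trans (at-spell y (fromℕ (suc m))) last)) (there here) }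
    }
    where
    -- The letters occupy the times 1 to `length y`, so the exit is reached at time `m + 1` at the
    -- latest.
    last : walk (false ∷ reverse y) (toℕ (fromℕ (suc m))) ≡ inj₁ 1F
    last rewrite toℕ-fromℕ m = walk-ends (reverse y) (≤-trans (≤-reflexive (length-reverse y)) y≤m)

  decode-spell : ∀ y → length y ≤ m → decode (toList (spell y)) ≡ y
  decode-spell y y≤m = trans
    (collect-walk [] (reverse y) (≤-trans (≤-reflexive (length-reverse y)) (m≤n⇒m≤1+n y≤m)))
    (reverse-involutive y)

  -- Evacuation by the final time is what keeps the spelled word within the certificate bound, so
  -- that an accepted decoded word proves membership.
  decode-short : ∀ w → IsSES w → length (decode (toList w)) ≤ m
  decode-short (_ ∷ w) ses = collect-short [] w (exit-only (IsSES.evacuated ses 0F))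

  N-final : ∀ w → IsSES w → N w (fromℕ (suc m)) ≡ 1
  N-final w ses with lookup w (fromℕ (suc m)) | IsSES.evacuated ses 0F
  ... | exit | _ = refl

  N-idle : ∀ t → N idle t ≡ 0
  N-idle t = cong (count atExit?) (lookup-replicate t origin)

  stay-idle : (w : Schedule) →
    stay (length (drop 1 (toList w))) (encStates (origin ∷ [])) ≡ encSchedule idle
  stay-idle (_ ∷ w) rewrite length-toList w =
    trans (stay-∙ (suc m) nil) (cong (encState origin ∙_) (stay-replicate (suc m)))

-- The instance attached to a word

abstract
  score : Bool → ℚ
  score b = if b then 1ℚ else 0ℚ

  score≤score-true : ∀ b → score b ℚ.≤ score true
  score≤score-true true  = ℚ.≤-refl
  score≤score-true false = from-yes (0ℚ ℚ.≤? 1ℚ)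

  score-true≤score : ∀ b → score true ℚ.≤ score b → T b
  score-true≤score true  _   = _
  score-true≤score false 1≤0 = ⊥-elim (from-no (1ℚ ℚ.≤? 0ℚ) 1≤0)

  -- The left side is the form that `𝔼N` takes on a one-point distribution.
  sum-score : ∀ b {k} → k ≡ (if b then 1 else 0) → 1ℚ ℚ.* (ℤ.+ k ℚ./ 1) ℚ.+ 0ℚ ≡ score b
  sum-score true  refl = refl
  sum-score false refl = refl

  0<1 : 0ℚ ℚ.< 1ℚ
  0<1 = from-yes (0ℚ ℚ.<? 1ℚ)

module _ {L : Language} (np : NP L) where
  open NP np renaming (degree to k)

  module _ (x : Word) where
    n m : ℕ
    n = length x
    m = poly k n

    open Schedules (suc m) G

    final : Time
    final = fromℕ (suc m)

    outcome : Schedule → Schedule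
    outcome es = if accepts x (decode (toList es)) then es else idle m

    response : Schedule → Distribution
    response es = (outcome es , 1ℚ) ∷ []

    response-pdf : ∀ es → IsSES es → IsPDF (response es)
    response-pdf es ses = record
      { support = (outcome-WES , 0<1 , ℚ.≤-refl) ∷ []
      ; unique  = [] ∷ []
      ; total   = refl
      }
      where
      outcome-WES : IsWES (outcome es)
      outcome-WES with accepts x (decode (toList es))
      ... | true  = IsSES.isWES ses
      ... | false = idle-WES m

    outcome-starts : ∀ es → Vec.head es ≡ origin → Vec.head (outcome es) ≡ origin
    outcome-starts es eq with accepts x (decode (toList es))
    ... | true  = eq
    ... | false = refl

    N-outcome : ∀ es → IsSES es → N (outcome es) final ≡ (if accepts x (decode (toList es)) then 1 else 0)
    N-outcome es ses with accepts x (decode (toList es))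
    ... | true  = N-final m es ses
    ... | false = N-idle m final

    expectation : ∀ es → IsSES es → 𝔼N (response es) final ≡ score (accepts x (decode (toList es)))
    expectation es ses = sum-score (accepts x (decode (toList es))) (N-outcome es ses)

    ruled≡outcome : ∀ es → ruled np x (toList es) ≡ encSchedule (outcome es)
    ruled≡outcome es with accepts x (decode (toList es))
    ... | true  = refl
    ... | false = stay-idle m es

    framework : EvacuationFramework 1 (suc m)
    framework = record
      { G       = G
      ; s₀      = origin
      ; β       = response
      ; β-pdf   = response-pdf
      ; β-start = λ es _ eq → outcome-starts es eq ∷ []
      }

  -- Final time `m + 1` means `m + 2` states, hence `2 + X`. The rule reads a schedule and holds `x`
  -- as a constant, so both sizes enter.
  scheduleSizeP inputSizeP budgetP : Poly
  scheduleSizeP = con 1 ⊕ con 8 ⊗ (con 2 ⊕ X)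
  inputSizeP    = scheduleSizeP ⊚ (con k ⊗ X ↑ k ⊕ con k) ⊕ (con 1 ⊕ con 4 ⊗ X)
  budgetP       = proj₁ (exec-rule np) ⊚ inputSizeP

  K : ℕ
  K = polyDegree budgetP

  initial-regs : ∀ a → initial a ≗ₛ store ⟨ a ∷ nil ∷ nil ∷ nil ∷ nil ∷ nil ∷ [] ∣ blank ⟩
  initial-regs a 0 = refl
  initial-regs a 1 = refl
  initial-regs a 2 = refl
  initial-regs a 3 = refl
  initial-regs a 4 = refl
  initial-regs a 5 = refl
  initial-regs a (suc (suc (suc (suc (suc (suc _)))))) = refl

  initial-bounded : ∀ {S} a → size a ≤ S → Bounded S ⟨ a ∷ nil ∷ nil ∷ nil ∷ nil ∷ nil ∷ [] ∣ blank ⟩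
  initial-bounded a a≤S = bounded λ y → subst (λ t → size t ≤ _) (initial-regs a y) (at-initial y)
    where
    at-initial : ∀ y → size (initial a y) ≤ _
    at-initial zero    = a≤S
    at-initial (suc _) = ≤-trans (0<size a) a≤S

  exec⇒computes : ∀ {O mode a b P S N} {p : Program mode} {δ : Config 6} →
    Exec O p ⟨ a ∷ nil ∷ nil ∷ nil ∷ nil ∷ nil ∷ [] ∣ blank ⟩ δ P S → store δ 0 ≡ b → ⟦ P ⟧ S ≤ N →
    Computes[ O ] p a b N
  exec⇒computes {a = a} (exec r eq t≤) δ0≡b P≤N with run-cong r (λ y → sym (initial-regs a y))
  ... | σ , r′ , eq′ = σ , _ , r′ , trans (sym (eq′ 0)) (trans (eq 0) δ0≡b) , ≤-trans t≤ P≤N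

  rule-computes : ∀ x es → Computes (rule np x) (Schedules.encSchedule (suc (m x)) G es)
    (Schedules.encDistribution (suc (m x)) G (response x es)) (poly K (n x))
  rule-computes x es =
    let δ , δ0≡ , r = proj₂ (exec-rule np) x (toList es) {S = ⟦ inputSizeP ⟧ (n x)}
          (≤-trans (size-word x) (m≤n+m _ (⟦ scheduleSizeP ⟧ (m x))))
          (initial-bounded _ (≤-trans (size-schedule es) (m≤m+n _ _)))
    in exec⇒computes r (trans δ0≡ (cong (λ t → (t ∙ encℚ 1ℚ) ∙ nil) (ruled≡outcome x es)))
         (⟦⟧≤poly budgetP (n x))

  instanceFor : Word → EPInstance
  instanceFor x = record
    { |P|    = 1
    ; tmax   = suc (m x)
    ; EF     = framework x
    ; D      = final x
    ; rule   = rule np x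
    ; budget = poly K (n x)
    ; rule-β = λ es _ → rule-computes x es
    }

  restricted : ∀ x → UnitEdges (instanceFor x) × AtMostTwoOrigins (instanceFor x)
             × DeterministicBehavior (instanceFor x)
  restricted x = (λ _ → refl , refl) , (0F , 0F , λ { 0F → inj₁ refl }) , (λ es _ → _ , refl)

  -- The reduction program

  tmaxExpr ruleExpr instanceExpr : Expr
  tmaxExpr = cons (quot nil) (var 5)
  -- The code of `rule np x`: 2 and 0 are the tags of sequence and assignment, the first 1 is the
  -- variable assigned and the second the tag of `quot`.
  ruleExpr = cons (quot (encUnary 2)) (cons
    (cons (quot (encUnary 0)) (cons (quot (encUnary 1)) (cons (quot (encUnary 1)) (var 1))))
    (quot (encProgram (answer np))))
  instanceExpr =
    cons (quot (encUnary 1)) (cons tmaxExpr (cons (quot (encUnary 2)) (cons (quot (encUnary 1)) (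
    cons (quot (encTable (λ (u , v) → encFin u ∙ encFin v) ends)) (
    cons (quot (encVec encBool EX)) (
    cons (quot (encTable encℤ (λ v → c (inj₁ v)))) (
    cons (quot (encTable encℤ (λ e → c (inj₂ e)))) (
    cons (quot (encTable encℤ (λ v → d (inj₁ v)))) (
    cons (quot (encTable encℤ (λ e → d (inj₂ e)))) (
    cons (quot (encPlace origin)) (cons tmaxExpr (
    cons ruleExpr (var 2)))))))))))))

  eval-instance : ∀ x {a j i} → eval instanceExpr
    (store ⟨ a ∷ encWord x ∷ encUnary (poly K (n x)) ∷ j ∷ i ∷ encUnary (m x) ∷ [] ∣ blank ⟩)
    ≡ encEPInstance (instanceFor x)
  -- The deadline is encoded through `toℕ (fromℕ (m x))`, the final time through `m x` itself.
  eval-instance x rewrite toℕ-fromℕ (m x) = refl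

  -- Register 5 keeps `m` while register 2 is reused for the budget. `tl` strips the `just` of the
  -- reply, and variable 6 is where the verifier leaves its verdict.
  reduction : Program oracle
  reduction = 1 ≔ var 0 ⨟ polynomial k ⨟ 5 ≔ var 2 ⨟ polynomial K
            ⨟ 0 ≔ask instanceExpr ⨟ 0 ≔ tl (var 0) ⨟ judge np ⨟ 0 ≔ var 6

  -- The oracle is arbitrary and its reply is charged by size, so polynomial time needs a bound on
  -- the reply. A schedule of the instance provides one, with 2 added for the `just`.
  exec-ask : ∀ {O x a j i S} →
    Bounded S ⟨ a ∷ encWord x ∷ encUnary (poly K (n x)) ∷ j ∷ i ∷ encUnary (m x) ∷ [] ∣ blank ⟩ →
    let reply = O (encEPInstance (instanceFor x)) in size reply ≤ 2 + ⟦ scheduleSizeP ⟧ (m x) →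
    Exec O (0 ≔ask instanceExpr)
      ⟨ a ∷ encWord x ∷ encUnary (poly K (n x)) ∷ j ∷ i ∷ encUnary (m x) ∷ [] ∣ blank ⟩
      ⟨ reply ∷ encWord x ∷ encUnary (poly K (n x)) ∷ j ∷ i ∷ encUnary (m x) ∷ [] ∣ blank ⟩
      (con 1 ⊕ (costP instanceExpr ⊕ (con 2 ⊕ scheduleSizeP))) S
  exec-ask {O} {x} {a} {j} {i} {S} b reply≤ = exec ask
    (λ y → trans (update-register (a ∷ _ ∷ _ ∷ j ∷ i ∷ _ ∷ []) blank 0F _ y)
      (cong
        (λ t → store ⟨ O t ∷ encWord x ∷ encUnary (poly K (n x)) ∷ j ∷ i ∷ encUnary (m x) ∷ [] ∣ blank ⟩ y)
        (eval-instance x {a} {j} {i})))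
    (s≤s (+-mono-≤ (cost-bound (get b) instanceExpr)
      (subst (λ t → size (O t) ≤ 2 + ⟦ scheduleSizeP ⟧ S) (sym (eval-instance x {a} {j} {i}))
        (≤-trans reply≤ (+-monoʳ-≤ 2 (⟦⟧-mono scheduleSizeP m≤S))))))
    where
    m≤S : m x ≤ S
    m≤S = ≤-trans (≤-reflexive (sym (spine-unary (m x)))) (≤-trans (spine≤size (encUnary (m x))) (get b 5))

  abstract
    exec-reduction : ∃[ P ] (∀ {O} x ss {S} →
      let reply = O (encEPInstance (instanceFor x)) in
      size reply ≤ 2 + ⟦ scheduleSizeP ⟧ (m x) → tail reply ≡ encStates ss →
      Bounded S ⟨ encWord x ∷ nil ∷ nil ∷ nil ∷ nil ∷ nil ∷ [] ∣ blank ⟩ →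
      ∃[ δ ] store δ 0 ≡ encBool (accepts x (decode ss)) ×
        Exec O {n = 6} reduction ⟨ encWord x ∷ nil ∷ nil ∷ nil ∷ nil ∷ nil ∷ [] ∣ blank ⟩ δ P S)
    exec-reduction = _ , λ {O} x ss {S} reply≤ tail≡ b →
      let r₁ = set 1F (var 0) b
          b₁ = exec-bounded r₁ b
          r₂ = poly-word k x b₁
          b₂ = exec-bounded r₂ b₁
          r₃ = set 5F (var 2) b₂
          b₃ = exec-bounded r₃ b₂
          r₄ = poly-word K x b₃
          b₄ = exec-bounded r₄ b₃
          r₅ = exec-ask {O} b₄ reply≤
          b₅ = exec-bounded r₅ b₄
          r₆ = tail-reply ss tail≡ b₅
          b₆ = exec-bounded r₆ b₅
          ρ , ρ0≡ , r₇ = proj₂ (exec-judge np) x ss b₆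
          b₇ = exec-bounded r₇ b₆
      in _ , ρ0≡ , (r₁ ⨾ᵇ r₂ ⨾ᵇ r₃ ⨾ᵇ r₄ ⨾ᵇ r₅ ⨾ᵇ r₆ ⨾ᵇ r₇ ⨾ᵇ set 0F (var 6) b₇)
      where
      poly-word : ∀ k′ x {O a acc y S} → Bounded S ⟨ a ∷ encWord x ∷ acc ∷ nil ∷ nil ∷ y ∷ [] ∣ blank ⟩ →
        Exec O {oracle} (polynomial k′) ⟨ a ∷ encWord x ∷ acc ∷ nil ∷ nil ∷ y ∷ [] ∣ blank ⟩
          ⟨ encUnary k′ ∷ encWord x ∷ encUnary (poly k′ (n x)) ∷ nil ∷ nil ∷ y ∷ [] ∣ blank ⟩
          (proj₁ (exec-polynomial k′)) S
      poly-word k′ x {y = y} b = exec-≗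
        (λ z → cong
          (λ l → store ⟨ encUnary k′ ∷ encWord x ∷ encUnary (poly k′ l) ∷ nil ∷ nil ∷ y ∷ [] ∣ blank ⟩ z)
          (spine-word x))
        (proj₂ (exec-polynomial k′) b)
      tail-reply : ∀ ss {O r a₁ a₂ a₃ a₄ a₅ S} → tail r ≡ encStates ss →
        Bounded S ⟨ r ∷ a₁ ∷ a₂ ∷ a₃ ∷ a₄ ∷ a₅ ∷ [] ∣ blank ⟩ →
        Exec O {oracle} (0 ≔ tl (var 0)) ⟨ r ∷ a₁ ∷ a₂ ∷ a₃ ∷ a₄ ∷ a₅ ∷ [] ∣ blank ⟩
          ⟨ encStates ss ∷ a₁ ∷ a₂ ∷ a₃ ∷ a₄ ∷ a₅ ∷ [] ∣ blank ⟩ (con 1 ⊕ costP (tl (var 0))) S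
      tail-reply ss {r = r} eq b rewrite sym eq = set 0F (tl (var 0)) b

  reductionP : Poly
  reductionP = proj₁ exec-reduction ⊚ (con 1 ⊕ con 4 ⊗ X)

  exec-reduction-word : ∀ O x ss → let reply = O (encEPInstance (instanceFor x)) in
    size reply ≤ 2 + ⟦ scheduleSizeP ⟧ (m x) → tail reply ≡ encStates ss →
    ∃[ δ ] store δ 0 ≡ encBool (accepts x (decode ss)) ×
      Exec O {n = 6} reduction ⟨ encWord x ∷ nil ∷ nil ∷ nil ∷ nil ∷ nil ∷ [] ∣ blank ⟩ δ
        (proj₁ exec-reduction) (1 + 4 * length x)
  exec-reduction-word O x ss reply≤ tail≡ =
    proj₂ exec-reduction {O} x ss {1 + 4 * length x} reply≤ tail≡
      (initial-bounded (encWord x) (size-word x))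

  reduction-computes : ∀ O x ss → let reply = O (encEPInstance (instanceFor x)) in
    size reply ≤ 2 + ⟦ scheduleSizeP ⟧ (m x) → tail reply ≡ encStates ss →
    Computes[ O ] reduction (encWord x) (encBool (accepts x (decode ss))) (poly (polyDegree reductionP) (n x))
  reduction-computes O x ss reply≤ tail≡ =
    let _ , δ0≡ , r = exec-reduction-word O x ss reply≤ tail≡
    in exec⇒computes {a = encWord x} {S = 1 + 4 * length x} r δ0≡ (⟦⟧≤poly reductionP (n x))

  -- Correctness of the reduction

  module _ (x : Word) where
    open EPInstance (instanceFor x) using (Feasible; Optimal)

    spell-feasible : ∀ y → length y ≤ m x → Feasible (spell (m x) y)
    spell-feasible y y≤m = spell-SES (m x) y y≤m , refl

    expectation-spell : ∀ y → length y ≤ m x → T (accepts x y) →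
      Schedules.𝔼N (suc (m x)) G (response x (spell (m x) y)) (final x) ≡ score true
    expectation-spell y y≤m acc = trans
      (expectation x (spell (m x) y) (spell-SES (m x) y y≤m))
      (cong score (trans (cong (accepts x) (decode-spell (m x) y y≤m)) (Equivalence.to T-≡ acc)))

    -- No expectation exceeds 1. This refutes the answer `nothing` when a certificate exists.
    spell-optimal : ∀ y → length y ≤ m x → T (accepts x y) → Optimal (final x) (spell (m x) y)
    spell-optimal y y≤m acc = spell-feasible y y≤m , λ es (ses , _) →
      subst₂ ℚ._≤_ (sym (expectation x es ses)) (sym (expectation-spell y y≤m acc)) (score≤score-true _)

    -- The plan spelling `y` attains expectation 1, hence so does an optimal plan, and only an
    -- accepted word yields that value.
    optimal-accepted : ∀ es → Optimal (final x) es → ∀ y → length y ≤ m x → T (accepts x y) →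
                       T (accepts x (decode (toList es)))
    optimal-accepted es ((ses , _) , best) y y≤m acc = score-true≤score _
      (subst₂ ℚ._≤_ (expectation-spell y y≤m acc) (expectation x es ses)
        (best (spell (m x) y) (spell-feasible y y≤m)))

  reduces : L ≤ᵀ (EP restrictedTo (λ I → UnitEdges I × AtMostTwoOrigins I × DeterministicBehavior I))
  reduces = record
    { reduction = reduction
    ; degree    = polyDegree reductionP
    ; decides   = decides
    }
    where
    decides : ∀ O →
      Solves O (EP restrictedTo (λ I → UnitEdges I × AtMostTwoOrigins I × DeterministicBehavior I)) →
      ∀ x → ∃[ b ]
        Computes[ O ] reduction (encWord x) (encBool b) (poly (polyDegree reductionP) (length x))
        × (L x ⇔ T b)
    decides O solves x with solves (instanceFor x , restricted x)
    ... | just es , reply≡ , optimal =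
      accepts x (decode (toList es)) ,
      reduction-computes O x (toList es)
        (≤-trans (≤-reflexive (cong size reply≡)) (+-monoʳ-≤ 2 (size-schedule es)))
        (cong tail reply≡) ,
      mk⇔ (λ x∈L → let y , y≤m , acc = Equivalence.to (correct x) x∈L
                   in optimal-accepted x es optimal y y≤m acc)
          (λ acc → Equivalence.from (correct x) (_ , decode-short (m x) es (proj₁ (proj₁ optimal)) , acc))
    -- The reply nil decodes to the empty word, itself a potential certificate.
    ... | nothing , reply≡ , none =
      accepts x [] ,
      reduction-computes O x [] (≤-trans (≤-reflexive (cong size reply≡)) (s≤s z≤n)) (cong tail reply≡) ,
      mk⇔ (λ x∈L → let y , y≤m , acc = Equivalence.to (correct x) x∈L
                   in ⊥-elim (none (spell (m x) y) (spell-optimal x y y≤m acc)))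
          (λ acc → Equivalence.from (correct x) ([] , z≤n , acc))

corollary2 : NP-hard (EP restrictedTo (λ I →
    UnitEdges I × AtMostTwoOrigins I × DeterministicBehavior I))
corollary2 L np = reduces np
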